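{- Let $\mathcal{L}$ be downward $\preceq$-closed and ccs with $\mathrm{Fin}\subseteq\mathcal{L}\subseteq\mathrm{Scat}$. Then $E_1\le_B\underline{\bowtie}^{\mathcal{L}}_{\mathrm{LO}}$.
   Context: Linear orders are reflexive and nonempty. $L\preceq L'$ means there is an embedding $f:L\to L'$, i.e. $x\le_L y\iff f(x)\le_{L'}f(y)$. $\mathrm{LO}\subseteq 2^{\mathbb{N}\times\mathbb{N}}$ is the Polish space of codes for linear orders with domain $\mathbb{N}$; $\mathrm{Fin}$ is the set of codes for nonempty linear orders on finite subsets of $\mathbb{N}$; $\mathrm{Lin}=\mathrm{Fin}\cup\mathrm{LO}$; $\mathrm{Scat}\subseteq\mathrm{Lin}$ is the set of scattered ones (those $L$ with $\mathbb{Q}\not\preceq L$). A class $\mathcal{L}\subseteq\mathrm{Lin}$ is downward $\preceq$-closed if $K\in\mathrm{Lin}$ and $K\preceq L\in\mathcal{L}$ imply $K\in\mathcal{L}$; membership in $\mathcal{L}$ is meant up to isomorphism. A subset $I$ of a linear order $L$ is convex if $x\le_L y\le_L z$ and $x,z\in I$ imply $y\in I$. For $A,B\subseteq L$ write $A\le_L B$ (resp. $A<_L B$) if $a\le_L b$ (resp. $a<_L b$) for all $a\in A$, $b\in B$. A $K$-convex partition of $L$ is a partition $(L_k)_{k\in K}$ of $L$ (into nonempty sets) such that $k<_K k'\iff L_k<_L L_{k'}$. The relation $L\trianglelefteq^{\mathcal{L}}L'$ holds iff there are $K\in\mathcal{L}$, a $K$-convex partition $(L_k)_{k\in K}$ of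 $L$, and an embedding $f$ of $L$ into $L'$ such that $f(L_k)$ is a convex subset of $L'$ for every $k\in K$. $\trianglelefteq^{\mathcal{L}}_{\mathrm{LO}}$ is its restriction to $\mathrm{LO}$, and $L\mathrel{\underline{\bowtie}^{\mathcal{L}}_{\mathrm{LO}}}L'$ iff $L\trianglelefteq^{\mathcal{L}}_{\mathrm{LO}}L'$ and $L'\trianglelefteq^{\mathcal{L}}_{\mathrm{LO}}L$. $\mathcal{L}$ is ccs (closed under convex sums) if for all $K,K'\in\mathcal{L}$ and every family $(K'_k)_{k\in K}$ of nonempty convex subsets of $K'$ such that $k_0<_K k_1\Rightarrow K'_{k_0}\le_{K'}K'_{k_1}$, we have $\sum_{k\in K}K'_k\in\mathcal{L}$, where $\sum_{k\in K}K'_k=\{(x,k): k\in K, x\in K'_k\}$ ordered antilexicographically. When $\mathcal{L}$ is ccs, $\trianglelefteq^{\mathcal{L}}$ is a quasi-order. $E_1$ is the equivalence relation on $\mathbb{R}^{\mathbb{N}}$ given by $(x_n)\mathrel{E_1}(y_n)$ iff there is $m$ with $x_n=y_n$ for all $n\ge m$. For binary relations $E$ on $X$ and $F$ on $Y$ (standard Borel spaces), $E\le_B F$ means there is a Borel map $\varphi:X\to Y$ with $x\mathrel{E}x'\iff\varphi(x)\mathrel{F}\varphi(x')$. -}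

module Defs where

open import Level using (Level; 0ℓ; _⊔_) renaming (suc to lsuc)
open import Data.Bool.Base using (Bool; T)
open import Data.Bool.Properties using (T-irrelevant)
open import Data.List.Base using (List)
open import Data.List.Relation.Unary.All using (All)
open import Data.Nat.Base as ℕ using (ℕ)
import Data.Nat.Properties as ℕ
open import Data.Product.Base using (Σ-syntax; ∃; ∃-syntax; _×_; _,_; proj₁; proj₂)
open import Data.Product.Properties using (≡-dec)
import Data.Product.Relation.Binary.Lex.NonStrict as Lex
open import Data.Rational.Base as ℚ using (ℚ)
import Data.Rational.Properties as ℚ
open import Data.Sum.Base using (_⊎_)
open import Function.Bundles using (_⇔_)
open import Relation.Binary.Bundles using (TotalOrder; DecTotalOrder)
import Relation.Binary.Construct.On as On
open import Relation.Binary.Core using (Rel)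
open import Relation.Binary.Morphism.Structures using (IsOrderMonomorphism; IsOrderIsomorphism)
import Relation.Binary.Properties.TotalOrder as TotalOrderProperties
open import Relation.Binary.PropositionalEquality.Core using (_≡_)
open import Relation.Binary.Structures using (IsTotalOrder)
open import Relation.Nullary.Decidable.Core using (yes)
open import Relation.Nullary.Negation.Core using (¬_)
open import Relation.Unary using (Pred; _∈_; _⊆_; _≐_; ∁; ⋃; _⊢_; Satisfiable)

private
  variable
    ℓ : Level

LinearOrder : Set₁
LinearOrder = TotalOrder 0ℓ 0ℓ 0ℓ

∣_∣ : LinearOrder → Set
∣ L ∣ = TotalOrder.Carrier L

-- An order embedding in the sense of  x ≤ y ⇔ f x ≤ f y ; that f respects
-- and reflects the underlying equality is then automatic by antisymmetry.
IsEmbedding : (L L′ : LinearOrder) → (∣ L ∣ → ∣ L′ ∣) → Set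
IsEmbedding L L′ = IsOrderMonomorphism L._≈_ L′._≈_ L._≤_ L′._≤_
  where module L = TotalOrder L; module L′ = TotalOrder L′

infix 4 _≼_ _≅_

_≼_ : LinearOrder → LinearOrder → Set
L ≼ L′ = ∃[ f ] IsEmbedding L L′ f

_≅_ : LinearOrder → LinearOrder → Set
L ≅ L′ = ∃[ f ] IsOrderIsomorphism L._≈_ L′._≈_ L._≤_ L′._≤_ f
  where module L = TotalOrder L; module L′ = TotalOrder L′

IsScattered : LinearOrder → Set
IsScattered L = ¬ (DecTotalOrder.totalOrder ℚ.≤-decTotalOrder ≼ L)

Pairwise : {A : Set} → Rel A 0ℓ → Rel (Pred A 0ℓ) 0ℓ
Pairwise _∼_ P Q = ∀ {x y} → x ∈ P → y ∈ Q → x ∼ y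

Convex : (L : LinearOrder) → Pred (Pred ∣ L ∣ 0ℓ) 0ℓ
Convex L P = ∀ {x y z} → x ≤ y → y ≤ z → x ∈ P → z ∈ P → y ∈ P
  where open TotalOrder L

Code : Set
Code = ℕ × ℕ → Bool

-- A reflexive relation determines its domain.
Dom : Code → Set
Dom c = ∃[ n ] T (c (n , n))

order : (c : Code) → Rel (Dom c) 0ℓ
order c (m , _) (n , _) = T (c (m , n))

FiniteDom FullDom : Pred Code 0ℓ
FiniteDom c = ∃[ b ] ∀ n → T (c (n , n)) → n ℕ.< b
FullDom   c = ∀ n → T (c (n , n))

-- Proofs of  T b  are irrelevant, so _≡_ on  Dom c  is equality of the
-- underlying natural numbers.
record Lin : Set where
  field
    code         : Code
    supported    : ∀ {m n} → T (code (m , n)) → T (code (m , m)) × T (code (n , n))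
    isTotalOrder : IsTotalOrder {A = Dom code} _≡_ (order code)
    nonempty     : Dom code
    finOrFull    : FiniteDom code ⊎ FullDom code

  totalOrder : LinearOrder
  totalOrder = record { isTotalOrder = isTotalOrder }

  decTotalOrder : DecTotalOrder 0ℓ 0ℓ 0ℓ
  decTotalOrder = TotalOrderProperties.decTotalOrder totalOrder
    (≡-dec ℕ._≟_ λ p q → yes (T-irrelevant p q))

open Lin using (code)

⟦_⟧ : Lin → LinearOrder
⟦_⟧ = Lin.totalOrder

Finite : Pred Lin 0ℓ
Finite L = FiniteDom (code L)

Full : Pred Lin 0ℓ
Full L = FullDom (code L)

Scat : Pred Lin 0ℓ
Scat L = IsScattered ⟦ L ⟧

LO : Set
LO = ∃ Full

DownwardClosed : Pred (Pred Lin ℓ) ℓ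
DownwardClosed 𝓛 = ∀ {K L} → ⟦ K ⟧ ≼ ⟦ L ⟧ → L ∈ 𝓛 → K ∈ 𝓛

-- A sum is not itself a code; membership of an abstract order in a class of codes
-- is membership of some isomorphic code.
infix 4 _∈≅_
_∈≅_ : LinearOrder → Pred Lin ℓ → Set ℓ
X ∈≅ 𝓛 = ∃[ S ] S ∈ 𝓛 × ⟦ S ⟧ ≅ X

-- Elements are triples  ((k , x) , x ∈ P k) .  The order is lexicographic with
-- k leading, i.e. antilexicographic for the pairs written (x , k).
ConvexSum : (K K′ : Lin) → (∣ ⟦ K ⟧ ∣ → Pred ∣ ⟦ K′ ⟧ ∣ 0ℓ) → LinearOrder
ConvexSum K K′ P =
  On.totalOrder (Lex.×-totalOrder (Lin.decTotalOrder K) ⟦ K′ ⟧) pair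
  where
  pair : Σ[ (k , x) ∈ ∣ ⟦ K ⟧ ∣ × ∣ ⟦ K′ ⟧ ∣ ] x ∈ P k → ∣ ⟦ K ⟧ ∣ × ∣ ⟦ K′ ⟧ ∣
  pair = proj₁

CCS : Pred (Pred Lin ℓ) (lsuc 0ℓ ⊔ ℓ)
CCS 𝓛 = ∀ {K K′} → K ∈ 𝓛 → K′ ∈ 𝓛 →
  (P : ∣ ⟦ K ⟧ ∣ → Pred ∣ ⟦ K′ ⟧ ∣ 0ℓ) →
  (∀ k → Satisfiable (P k)) →
  (∀ k → Convex ⟦ K′ ⟧ (P k)) →
  (∀ {k₀ k₁} → TotalOrderProperties._<_ ⟦ K ⟧ k₀ k₁ →
    Pairwise (TotalOrder._≤_ ⟦ K′ ⟧) (P k₀) (P k₁)) →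
  ConvexSum K K′ P ∈≅ 𝓛

record IsConvexPartition (K L : Lin) (P : ∣ ⟦ K ⟧ ∣ → Pred ∣ ⟦ L ⟧ ∣ 0ℓ) : Set where
  private
    module K = TotalOrderProperties ⟦ K ⟧
    module L = TotalOrderProperties ⟦ L ⟧
  field
    nonempty : ∀ k → Satisfiable (P k)
    disjoint : ∀ {k k′ x} → x ∈ P k → x ∈ P k′ → k ≡ k′
    covering : ∀ x → ∃[ k ] x ∈ P k
    ordered  : ∀ {k k′} → k K.< k′ ⇔ Pairwise L._<_ (P k) (P k′)

Image : {A B : Set} → (A → B) → Pred A 0ℓ → Pred B 0ℓ
Image f P y = ∃[ x ] x ∈ P × f x ≡ y

infix 4 _⊴[_]_

_⊴[_]_ : Lin → Pred Lin ℓ → Lin → Set (lsuc 0ℓ ⊔ ℓ)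
L ⊴[ 𝓛 ] L′ =
  ∃[ K ] K ∈ 𝓛 ×
  Σ[ P ∈ (∣ ⟦ K ⟧ ∣ → Pred ∣ ⟦ L ⟧ ∣ 0ℓ) ] IsConvexPartition K L P ×
  ∃[ f ] IsEmbedding ⟦ L ⟧ ⟦ L′ ⟧ f × (∀ k → Convex ⟦ L′ ⟧ (Image f (P k)))

⋈[_] : Pred Lin ℓ → Rel LO (lsuc 0ℓ ⊔ ℓ)
⋈[ 𝓛 ] (L , _) (L′ , _) = L ⊴[ 𝓛 ] L′ × L′ ⊴[ 𝓛 ] L

-- The sets  base i  are meant to form a base of the topology (each finite
-- intersection is a union of them); all the spaces constructed below satisfy this.
record Space : Set₁ where
  field
    Carrier : Set
    Index   : Set
    base    : Index → Pred Carrier 0ℓ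

open Space using (Carrier)

Open : (X : Space) → Pred (Pred (Carrier X) 0ℓ) 0ℓ
Open X U = ∀ {x} → x ∈ U → ∃[ i ] x ∈ base i × base i ⊆ U
  where open Space X using (base)

data Borel (X : Space) : Pred (Pred (Carrier X) 0ℓ) (lsuc 0ℓ) where
  open-set   : ∀ {U} → Open X U → Borel X U
  complement : ∀ {A} → Borel X A → Borel X (∁ A)
  union      : ∀ {A : ℕ → Pred (Carrier X) 0ℓ} → (∀ n → Borel X (A n)) → Borel X (⋃ ℕ A)
  resp-≐     : ∀ {A B} → A ≐ B → Borel X A → Borel X B

IsBorelMap : (X Y : Space) → Pred (Carrier X → Carrier Y) (lsuc 0ℓ)
IsBorelMap X Y φ = ∀ {B} → Borel Y B → Borel X (φ ⊢ B)

BorelReducible : ∀ {a b} (X Y : Space) → Rel (Carrier X) a → Rel (Carrier Y) b →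
                 Set (lsuc 0ℓ ⊔ a ⊔ b)
BorelReducible X Y E F =
  ∃[ φ ] IsBorelMap X Y φ × (∀ x x′ → E x x′ ⇔ F (φ x) (φ x′))

discrete : Set → Space
discrete A = record { Carrier = A ; Index = A ; base = λ a x → x ≡ a }

-- The product topology: a basic open set restricts finitely many coordinates.
power : Set → Space → Space
power I X = record
  { Carrier = I → Space.Carrier X
  ; Index   = List (I × Space.Index X)
  ; base    = λ cs x → All (λ (i , j) → x i ∈ Space.base X j) cs
  }

induced : (X : Space) {A : Set} → (A → Carrier X) → Space
induced X {A} f = record { Carrier = A ; Index = Space.Index X ; base = λ i → f ⊢ Space.base X i }

LOSpace : Space
LOSpace = induced (power (ℕ × ℕ) (discrete Bool)) {LO} (λ (L , _) → code L)

-- Dedekind cuts, given by the set of rationals strictly below the real.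
-- Cuts are Bool-valued; under excluded middle these are all the cuts.
record ℝ : Set where
  field
    below     : ℚ → Bool
    inhabited : ∃[ q ] T (below q)
    bounded   : ∃[ q ] ¬ T (below q)
    downward  : ∀ {p q} → p ℚ.< q → T (below q) → T (below p)
    rounded   : ∀ {p} → T (below p) → ∃[ q ] p ℚ.< q × T (below q)

infix 4 _<ᴿ_ _ᴿ<_ _≈ᴿ_

_<ᴿ_ : ℚ → ℝ → Set
q <ᴿ x = T (ℝ.below x q)

_ᴿ<_ : ℝ → ℚ → Set
x ᴿ< q = ∃[ r ] r ℚ.< q × ¬ (r <ᴿ x)

_≈ᴿ_ : Rel ℝ 0ℓ
x ≈ᴿ y = ∀ q → ℝ.below x q ≡ ℝ.below y q

ℝSpace : Space
ℝSpace = record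
  { Carrier = ℝ
  ; Index   = ℚ × ℚ
  ; base    = λ (p , q) x → p <ᴿ x × x ᴿ< q
  }

ℝ^ℕ : Space
ℝ^ℕ = power ℕ ℝSpace

-- Open, hence Borel, subsets of ℝ^ℕ are invariant under coordinatewise _≈ᴿ_,
-- so Borel maps send equal sequences of reals to equal codes.
E₁ : Rel (ℕ → ℝ) 0ℓ
E₁ x y = ∃[ m ] ∀ n → m ℕ.≤ n → x n ≈ᴿ y n

{-# OPTIONS --safe #-}
module Submission where

-- The reduction.  A sequence x of reals is sent to a suborder L(x) of a
-- lexicographic order of tuples (α , i , b , q , s , j), where α is a list of
-- natural numbers, i is a natural number (ordered in reverse), b is a Boolean
-- (false before true), q and s are rational, and j is at most w(i , q) for a
-- fixed injective weight w.  For each (α , i , b , q) the tuples form a column: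
-- a rational sequence of chains with w(i , q) + 1 elements.  There are two
-- kinds of columns.
--
--   * Left columns: α is empty, i and q are arbitrary, and b says whether q is
--     below the real x i.  So at each i the rationals are rearranged, those
--     outside the cut x i coming first.
--   * Room columns: α lists the exponents of the Cantor normal form of an
--     ordinal below ω^ω, i is less than the last exponent, and b and q are
--     arbitrary.  These do not depend on x, and only finitely many values of i
--     occur in the room columns before a given one.
--
-- If x and y agree from m onwards, then L(x) embeds into L(y) in finitely many
-- convex pieces: the left columns with i at least m stay where they are; for
-- i below m the two halves of the left part at i go into the position ω^m of
-- the room, where there is space for every half of every cut; and the room is
-- shifted past them by left addition of ω^m.
--
-- Conversely, let L(x) embed into L(y) with convex pieces indexed by a
-- scattered K.  The chains of a column form a copy of ℚ, which does not embed
-- into K, so two of them meet the same piece, and a chain strictly between these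
-- two goes onto a chain of L(y), by convexity of the image.  As the length of a chain determines (i , q),
-- a part of each column goes into a column with the same label.  If some point
-- of the left columns goes into the room, the left columns with large i lie
-- before it and have labels that do not occur in the room so far down, so they
-- go to left columns.  Thus for all large i the arrangement of the rationals by
-- the cut x i is the arrangement by y i, and therefore x i = y i.
--
-- The map is Borel since each entry of the code of L(x) depends on at most two
-- conditions of the form "q is below x i", each of which is open.

open import Defs
open import Level using (Level; 0ℓ; _⊔_; Lift; lift; lower) renaming (suc to lsuc)
open import Axiom.ExcludedMiddle using (ExcludedMiddle)
open import Relation.Unary using (Pred; _⊆_; _∈_)
open import Data.Bool.Base as Bool using (Bool; true; false; T; f<t)
import Data.Bool.Properties as Bool
open import Data.Empty using (⊥; ⊥-elim)
open import Data.Integer.Base as ℤ using (ℤ; +_; -[1+_])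
open import Data.List.Base using (List; []; _∷_)
open import Data.List.Relation.Binary.Lex.Strict as List using (Lex-<; halt; this; next; base)
open import Data.List.Relation.Binary.Pointwise using (Pointwise-≡⇒≡)
open import Data.List.Relation.Unary.All using ([]; _∷_)
open import Data.Nat.Base as ℕ using (ℕ; zero; suc; z≤n; s≤s)
import Data.Nat.Properties as ℕ
open import Data.Product.Base using (∃-syntax; _×_; _,_; proj₁; proj₂)
open import Data.Product.Relation.Binary.Lex.Strict using (×-Lex; ×-isStrictTotalOrder)
open import Data.Rational.Base as ℚ using (ℚ; 0ℚ; 1ℚ; ↥_; ↧ₙ_; *≡*)
import Data.Rational.Properties as ℚ
open import Data.Sum.Base using (_⊎_; inj₁; inj₂)
open import Function.Base using (_∘_; _on_; id)
open import Function.Bundles using (_↔_; mk↔ₛ′; Inverse; Equivalence; mk⇔)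
open import Function.Definitions using (Injective)
open import Relation.Binary.Bundles using (TotalOrder; DecTotalOrder)
import Relation.Binary.Construct.Flip.Ord as Flip
open import Relation.Binary.Core using (Rel)
open import Relation.Binary.Definitions using (Tri; tri<; tri≈; tri>)
open import Relation.Binary.Morphism.Structures using (IsOrderMonomorphism)
import Relation.Binary.Properties.TotalOrder as TotalOrderProperties
open import Relation.Binary.PropositionalEquality
  using (_≡_; _≢_; refl; sym; trans; cong; cong₂; subst; subst₂; isEquivalence)
open import Relation.Binary.Structures using (IsStrictTotalOrder)
open import Relation.Nullary.Decidable.Core
  using (Dec; yes; no; map′; isNo; isYes; toWitness; fromWitness; toWitnessFalse; fromWitnessFalse)
open import Relation.Nullary.Negation.Core using (¬_; contradiction)

-- Excluded middle

lowerEM : ∀ {a} b → ExcludedMiddle (a ⊔ b) → ExcludedMiddle a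
lowerEM b em {P} = map′ lower lift (em {Lift b P})

-- Bijections with the natural numbers

double : ℕ → ℕ
double zero    = zero
double (suc n) = suc (suc (double n))

double-injective : ∀ {m n} → double m ≡ double n → m ≡ n
double-injective {zero}  {zero}  _  = refl
double-injective {suc m} {suc n} eq =
  cong suc (double-injective (ℕ.suc-injective (ℕ.suc-injective eq)))

double≢suc-double : ∀ m n → double m ≢ suc (double n)
double≢suc-double (suc m) (suc n) eq =
  double≢suc-double m n (ℕ.suc-injective (ℕ.suc-injective eq))

n≤double-n : ∀ n → n ℕ.≤ double n
n≤double-n zero    = z≤n
n≤double-n (suc n) = s≤s (ℕ.m≤n⇒m≤1+n (n≤double-n n))

-- The injection of ℕ × ℕ into ℕ whose value on (a , b) is, in binary, that
-- of b followed by a digit 0 and a digits 1.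
pair : ℕ → ℕ → ℕ
pair zero    b = double b
pair (suc a) b = suc (double (pair a b))

pair-injective : ∀ a a′ {b b′} → pair a b ≡ pair a′ b′ → a ≡ a′ × b ≡ b′
pair-injective zero    zero     eq = refl , double-injective eq
pair-injective zero    (suc a′) eq = contradiction eq (double≢suc-double _ (pair a′ _))
pair-injective (suc a) zero     eq = contradiction (sym eq) (double≢suc-double _ (pair a _))
pair-injective (suc a) (suc a′) eq
  with refl , b≡b′ ← pair-injective a a′ (double-injective (ℕ.suc-injective eq)) = refl , b≡b′

n≤pair : ∀ a b → b ℕ.≤ pair a b
n≤pair zero    b = n≤double-n b
n≤pair (suc a) b = ℕ.m≤n⇒m≤1+n (ℕ.≤-trans (n≤pair a b) (n≤double-n _))

m≤pair : ∀ a b → a ℕ.≤ pair a b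
m≤pair zero    b = z≤n
m≤pair (suc a) b = s≤s (ℕ.≤-trans (m≤pair a b) (n≤double-n _))

encodeℤ : ℤ → ℕ
encodeℤ (+ n)    = pair 0 n
encodeℤ -[1+ n ] = pair 1 n

encodeℤ-injective : Injective _≡_ _≡_ encodeℤ
encodeℤ-injective {+ m}      {+ n}      eq = cong +_ (proj₂ (pair-injective 0 0 eq))
encodeℤ-injective {+ m}      { -[1+ n ]} eq = contradiction (proj₁ (pair-injective 0 1 {m} {n} eq)) λ ()
encodeℤ-injective { -[1+ m ]} {+ n}      eq = contradiction (proj₁ (pair-injective 1 0 {m} {n} eq)) λ ()
encodeℤ-injective { -[1+ m ]} { -[1+ n ]} eq = cong -[1+_] (proj₂ (pair-injective 1 1 eq))

encodeℚ : ℚ → ℕ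
encodeℚ q = pair (encodeℤ (↥ q)) (↧ₙ q)

encodeℚ-injective : Injective _≡_ _≡_ encodeℚ
encodeℚ-injective {p} {q} eq with a , b ← pair-injective (encodeℤ (↥ p)) (encodeℤ (↥ q)) eq =
  ℚ.≃⇒≡ (*≡* (cong₂ ℤ._*_ (encodeℤ-injective {↥ p} {↥ q} a) (cong +_ (sym b))))

encodeList : List ℕ → ℕ
encodeList []      = 0
encodeList (a ∷ l) = suc (pair a (encodeList l))

encodeList-injective : Injective _≡_ _≡_ encodeList
encodeList-injective {[]}    {[]}    _  = refl
encodeList-injective {a ∷ l} {b ∷ m} eq
  with refl , e ← pair-injective a b (ℕ.suc-injective eq) = cong (a ∷_) (encodeList-injective e)

-- An encoding with unbounded values can be compressed to a bijection with ℕ: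
-- an element is sent to the number of encodings below its own.
module _ (em : ExcludedMiddle 0ℓ) {C : Set} (encode : C → ℕ)
         (injective : Injective _≡_ _≡_ encode)
         (unbounded : ∀ n → ∃[ c ] n ℕ.≤ encode c) where

  private
    Hit : ℕ → Set
    Hit n = ∃[ c ] encode c ≡ n

    bump : {P : Set} → Dec P → ℕ → ℕ
    bump (yes _) n = suc n
    bump (no  _) n = n

    count : ℕ → ℕ
    count zero    = zero
    count (suc n) = bump (em {Hit n}) (count n)

    count-hit : ∀ n → Hit n → count (suc n) ≡ suc (count n)
    count-hit n hit with em {Hit n}
    ... | yes _   = refl
    ... | no  ¬hit = contradiction hit ¬hit

    count-step : ∀ n → count n ℕ.≤ count (suc n)
    count-step n with em {Hit n}
    ... | yes _ = ℕ.n≤1+n _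
    ... | no  _ = ℕ.≤-refl

    count-mono : ∀ {m n} → m ℕ.≤′ n → count m ℕ.≤ count n
    count-mono ℕ.≤′-refl           = ℕ.≤-refl
    count-mono (ℕ.≤′-step {n} m≤n) = ℕ.≤-trans (count-mono m≤n) (count-step n)

    rank : C → ℕ
    rank c = count (encode c)

    rank-mono : ∀ {c d} → encode c ℕ.< encode d → rank c ℕ.< rank d
    rank-mono {c} c<d =
      subst (ℕ._≤ _) (count-hit _ (c , refl)) (count-mono (ℕ.≤⇒≤′ c<d))

    rank-injective : Injective _≡_ _≡_ rank
    rank-injective {c} {d} eq with ℕ.<-cmp (encode c) (encode d)
    ... | tri< c<d _ _ = contradiction (rank-mono {c} {d} c<d) (ℕ.<-irrefl eq)
    ... | tri≈ _ c≡d _ = injective c≡d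
    ... | tri> _ _ d<c = contradiction (rank-mono {d} {c} d<c) (ℕ.<-irrefl (sym eq))

    -- The least value of encode from a onwards has rank count a.
    next-hit : ∀ a d → Hit (d ℕ.+ a) → ∃[ c ] rank c ≡ count a
    next-hit a d hit with em {Hit a} in eq
    ... | yes (c , c↦a) = c , cong count c↦a
    next-hit a zero    hit | no ¬hit = contradiction hit ¬hit
    next-hit a (suc d) hit | no ¬hit
      with c , c↦ ← next-hit (suc a) d (subst Hit (sym (ℕ.+-suc d a)) hit) =
      c , trans c↦ (cong (λ d → bump d (count a)) eq)

    next-hit-from : ∀ a → ∃[ c ] rank c ≡ count a
    next-hit-from a with c , a≤c ← unbounded a =
      next-hit a (encode c ℕ.∸ a) (c , sym (ℕ.m∸n+n≡m a≤c))

    rank-surjective : ∀ n → ∃[ c ] rank c ≡ n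
    rank-surjective zero = next-hit-from 0
    rank-surjective (suc n) with c , c↦n ← rank-surjective n
      with d , d↦ ← next-hit-from (suc (encode c)) =
      d , trans d↦ (trans (count-hit _ (c , refl)) (cong suc c↦n))

  enumerate : C ↔ ℕ
  enumerate = mk↔ₛ′ rank (proj₁ ∘ rank-surjective) (proj₂ ∘ rank-surjective)
    (λ c → rank-injective (proj₂ (rank-surjective (rank c))))

≡-Dom : ∀ c {k l : Dom c} → proj₁ k ≡ proj₁ l → k ≡ l
≡-Dom c {n , p} {.n , q} refl = cong (n ,_) (Bool.T-irrelevant p q)

-- Linear orders on ℕ from strict total orders

module StrictOrder {C : Set} {_<_ : Rel C 0ℓ} (sto : IsStrictTotalOrder _≡_ _<_) where
  open IsStrictTotalOrder sto public using (compare; _<?_; irrefl; asym) renaming (trans to <-trans)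

  connex : ∀ {x y} → ¬ (x < y) → ¬ (y < x) → x ≡ y
  connex {x} {y} x≮y y≮x with compare x y
  ... | tri< x<y _ _ = contradiction x<y x≮y
  ... | tri≈ _ x≡y _ = x≡y
  ... | tri> _ _ y<x = contradiction y<x y≮x

  <-≮-trans : ∀ {x y z} → x < y → ¬ (z < y) → x < z
  <-≮-trans {x} {y} {z} x<y z≮y with compare y z
  ... | tri< y<z _ _  = <-trans x<y y<z
  ... | tri≈ _ refl _ = x<y
  ... | tri> _ _ z<y  = contradiction z<y z≮y

module _ {C : Set} (C↔ℕ : C ↔ ℕ) {_<_ : Rel C 0ℓ} (sto : IsStrictTotalOrder _≡_ _<_) where
  open Inverse C↔ℕ using () renaming (to to index; from to point)
  open StrictOrder sto

  codeOf : Code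
  codeOf (m , n) = isNo (point n <? point m)

  private
    point-injective : Injective _≡_ _≡_ point
    point-injective {m} {n} eq =
      trans (sym (Inverse.strictlyInverseˡ C↔ℕ m))
        (trans (cong index eq) (Inverse.strictlyInverseˡ C↔ℕ n))

    intro : ∀ {m n} → ¬ (point n < point m) → T (codeOf (m , n))
    intro {m} {n} = fromWitnessFalse {a? = point n <? point m}

    elim : ∀ {m n} → T (codeOf (m , n)) → ¬ (point n < point m)
    elim {m} {n} = toWitnessFalse {a? = point n <? point m}

    full : FullDom codeOf
    full n = intro (irrefl refl)

    total : ∀ m n → T (codeOf (m , n)) ⊎ T (codeOf (n , m))
    total m n with point n <? point m
    ... | no  _   = inj₁ _
    ... | yes n<m = inj₂ (intro (asym n<m))

  -- The order on ℕ transported from a strict total order along a bijection.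
  lin : Lin
  lin = record
    { code         = codeOf
    ; supported    = λ {m} {n} _ → full m , full n
    ; isTotalOrder = record
      { isPartialOrder = record
        { isPreorder = record
          { isEquivalence = isEquivalence
          ; reflexive     = λ { {k} refl → proj₂ k }
          ; trans         = λ k≤l l≤m → intro λ m<k → elim l≤m (<-≮-trans m<k (elim k≤l))
          }
        ; antisym = λ k≤l l≤k → ≡-Dom codeOf (point-injective (connex (elim l≤k) (elim k≤l)))
        }
      ; total = λ (m , _) (n , _) → total m n
      }
    ; nonempty     = 0 , full 0
    ; finOrFull    = inj₂ full
    }

  lin-full : Full lin
  lin-full = full

  toPoint : ∣ ⟦ lin ⟧ ∣ → C
  toPoint (n , _) = point n

  fromPoint : C → ∣ ⟦ lin ⟧ ∣
  fromPoint c = index c , full _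

  toPoint-fromPoint : ∀ c → toPoint (fromPoint c) ≡ c
  toPoint-fromPoint = Inverse.strictlyInverseʳ C↔ℕ

  fromPoint-toPoint : ∀ l → fromPoint (toPoint l) ≡ l
  fromPoint-toPoint (n , _) = ≡-Dom codeOf (Inverse.strictlyInverseˡ C↔ℕ n)

  ≤⇒≮ : ∀ k l → TotalOrder._≤_ ⟦ lin ⟧ k l → ¬ (toPoint l < toPoint k)
  ≤⇒≮ _ _ = elim

  ≮⇒≤ : ∀ k l → ¬ (toPoint l < toPoint k) → TotalOrder._≤_ ⟦ lin ⟧ k l
  ≮⇒≤ _ _ = intro

  <ᴸ⇒< : ∀ {k l} → TotalOrderProperties._<_ ⟦ lin ⟧ k l → toPoint k < toPoint l
  <ᴸ⇒< {k} {l} (k≤l , k≢l) with compare (toPoint k) (toPoint l)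
  ... | tri< k<l _ _ = k<l
  ... | tri≈ _ k≡l _ = contradiction (≡-Dom codeOf (point-injective k≡l)) k≢l
  ... | tri> _ _ l<k = contradiction l<k (elim k≤l)

  <⇒<ᴸ : ∀ {k l} → toPoint k < toPoint l → TotalOrderProperties._<_ ⟦ lin ⟧ k l
  <⇒<ᴸ k<l = intro (asym k<l) , λ { refl → irrefl refl k<l }

-- Piecewise convex embeddings

-- An embedding together with a partition into pieces indexed by K.  The
-- partition is given by the function that sends a point to the index of its
-- piece; some indices may have an empty piece.  The field convex says that
-- the image of each piece is convex.
record PiecewiseEmbedding {C D : Set} (_<₁_ : Rel C 0ℓ) (_<₂_ : Rel D 0ℓ) (K : Lin) : Set where
  field
    piece      : C → ∣ ⟦ K ⟧ ∣
    piece-mono : ∀ {x y} → x <₁ y → TotalOrder._≤_ ⟦ K ⟧ (piece x) (piece y)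
    map        : C → D
    map-mono   : ∀ {x y} → x <₁ y → map x <₂ map y
    convex     : ∀ {x z w} → piece x ≡ piece z → map x <₂ w → w <₂ map z →
                 ∃[ y ] piece y ≡ piece x × map y ≡ w

module _ {C D : Set} {_<₁_ : Rel C 0ℓ} {_<₂_ : Rel D 0ℓ}
         (sto₁ : IsStrictTotalOrder _≡_ _<₁_) (sto₂ : IsStrictTotalOrder _≡_ _<₂_)
         {K} (e : PiecewiseEmbedding _<₁_ _<₂_ K) where
  open PiecewiseEmbedding e
  private
    module S₁ = StrictOrder sto₁
    module S₂ = StrictOrder sto₂

  map-reflects : ∀ {x y} → map x <₂ map y → x <₁ y
  map-reflects {x} {y} fx<fy with S₁.compare x y
  ... | tri< x<y _ _  = x<y
  ... | tri≈ _ refl _ = contradiction fx<fy (S₂.irrefl refl)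
  ... | tri> _ _ y<x  = contradiction (map-mono y<x) (S₂.asym fx<fy)

  map-injective : Injective _≡_ _≡_ map
  map-injective {x} {y} eq with S₁.compare x y
  ... | tri< x<y _ _ = contradiction (map-mono x<y) (S₂.irrefl eq)
  ... | tri≈ _ x≡y _ = x≡y
  ... | tri> _ _ y<x = contradiction (map-mono y<x) (S₂.irrefl (sym eq))

module _ {C D : Set} (C↔ℕ : C ↔ ℕ) (D↔ℕ : D ↔ ℕ) {_<₁_ : Rel C 0ℓ} {_<₂_ : Rel D 0ℓ}
         (sto₁ : IsStrictTotalOrder _≡_ _<₁_) (sto₂ : IsStrictTotalOrder _≡_ _<₂_) where
  private
    module S₁ = StrictOrder sto₁
    module S₂ = StrictOrder sto₂
    L₁ = lin C↔ℕ sto₁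
    L₂ = lin D↔ℕ sto₂
    to₁ = toPoint C↔ℕ sto₁
    to₂ = toPoint D↔ℕ sto₂
    from₁ = fromPoint C↔ℕ sto₁
    from₂ = fromPoint D↔ℕ sto₂
    to-from₁ = toPoint-fromPoint C↔ℕ sto₁
    to-from₂ = toPoint-fromPoint D↔ℕ sto₂
    from-to₁ = fromPoint-toPoint C↔ℕ sto₁
    from-to₂ = fromPoint-toPoint D↔ℕ sto₂

  ⊴⇒piecewise : ∀ {ℓ} {𝓛 : Pred Lin ℓ} → L₁ ⊴[ 𝓛 ] L₂ →
                ∃[ K ] K ∈ 𝓛 × PiecewiseEmbedding _<₁_ _<₂_ K
  ⊴⇒piecewise (K , K∈𝓛 , P , isP , f , f-emb , f-convex) = K , K∈𝓛 , record
    { piece      = pc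
    ; piece-mono = mono
    ; map        = to₂ ∘ f ∘ from₁
    ; map-mono   = λ {x} {y} x<y → <ᴸ⇒< D↔ℕ sto₂ (lift-< (<⇒<ᴸ C↔ℕ sto₁
                     (subst₂ _<₁_ (sym (to-from₁ x)) (sym (to-from₁ y)) x<y)))
    ; convex     = conv
    }
    where
    open IsConvexPartition isP
    module K = TotalOrder ⟦ K ⟧
    module F = IsOrderMonomorphism f-emb
    lift-< : ∀ {k l} → TotalOrderProperties._<_ ⟦ L₁ ⟧ k l → TotalOrderProperties._<_ ⟦ L₂ ⟧ (f k) (f l)
    lift-< (k≤l , k≢l) = F.mono k≤l , k≢l ∘ F.injective
    pc : C → ∣ ⟦ K ⟧ ∣
    pc c = proj₁ (covering (from₁ c))
    mono : ∀ {x y} → x <₁ y → pc x K.≤ pc y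
    mono {x} {y} x<y with K.total (pc x) (pc y)
    ... | inj₁ x≤y = x≤y
    ... | inj₂ y≤x with DecTotalOrder._≟_ (Lin.decTotalOrder K) (pc x) (pc y)
    ...   | yes x≡y = K.reflexive x≡y
    ...   | no  x≢y = contradiction
      (subst₂ _<₁_ (to-from₁ y) (to-from₁ x) (<ᴸ⇒< C↔ℕ sto₁
        (Equivalence.to ordered (y≤x , x≢y ∘ sym) (proj₂ (covering _)) (proj₂ (covering _)))))
      (S₁.asym x<y)
    conv : ∀ {x z w} → pc x ≡ pc z → to₂ (f (from₁ x)) <₂ w → w <₂ to₂ (f (from₁ z)) →
           ∃[ y ] pc y ≡ pc x × to₂ (f (from₁ y)) ≡ w
    conv {x} {z} {w} eq x<w w<z
      with y , y∈P , fy≡ ← f-convex (pc x) {f (from₁ x)} {from₂ w} {f (from₁ z)}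
             (≮⇒≤ D↔ℕ sto₂ (f (from₁ x)) (from₂ w) (S₂.asym (subst (_ <₂_) (sym (to-from₂ w)) x<w)))
             (≮⇒≤ D↔ℕ sto₂ (from₂ w) (f (from₁ z)) (S₂.asym (subst (_<₂ _) (sym (to-from₂ w)) w<z)))
             (_ , proj₂ (covering _) , refl)
             (_ , subst (λ k → P k _) (sym eq) (proj₂ (covering _)) , refl) =
      to₁ y
      , disjoint (proj₂ (covering _)) (subst (P _) (sym (from-to₁ y)) y∈P)
      , trans (cong (to₂ ∘ f) (from-to₁ y)) (trans (cong to₂ fy≡) (to-from₂ w))

  piecewise⇒⊴ : ∀ {ℓ} {𝓛 : Pred Lin ℓ} {K} → K ∈ 𝓛 → (e : PiecewiseEmbedding _<₁_ _<₂_ K) →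
                (∀ k → ∃[ c ] PiecewiseEmbedding.piece e c ≡ k) → L₁ ⊴[ 𝓛 ] L₂
  piecewise⇒⊴ {K = K} K∈𝓛 e onto = K , K∈𝓛 , (λ k l → piece (to₁ l) ≡ k) , record
    { nonempty = λ k → from₁ (proj₁ (onto k)) , trans (cong piece (to-from₁ _)) (proj₂ (onto k))
    ; disjoint = λ { refl x∈ → x∈ }
    ; covering = λ x → piece (to₁ x) , refl
    ; ordered  = λ {k} {k′} → mk⇔
        (λ { (k≤k′ , k≢k′) {x} {y} refl refl → <⇒<ᴸ C↔ℕ sto₁ (lt x y k≤k′ k≢k′) })
        (gt k k′)
    } , f , record
      { isOrderHomomorphism = record
        { cong = cong _
        ; mono = λ {x} {y} x≤y → ≮⇒≤ D↔ℕ sto₂ (f x) (f y) (λ fy<fx → ≤⇒≮ C↔ℕ sto₁ x y x≤y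
                   (map-reflects sto₁ sto₂ e (subst₂ _<₂_ (to-from₂ _) (to-from₂ _) fy<fx))) }
      ; injective = λ {x} {y} eq → trans (sym (from-to₁ x)) (trans
                   (cong from₁ (map-injective sto₁ sto₂ e
                     (trans (sym (to-from₂ _)) (trans (cong to₂ eq) (to-from₂ _)))))
                   (from-to₁ y))
      ; cancel    = λ {x} {y} fx≤fy → ≮⇒≤ C↔ℕ sto₁ x y (λ y<x → ≤⇒≮ D↔ℕ sto₂ (f x) (f y) fx≤fy
                   (subst₂ _<₂_ (sym (to-from₂ _)) (sym (to-from₂ _)) (map-mono y<x)))
      } , conv
    where
    open PiecewiseEmbedding e
    module K = TotalOrder ⟦ K ⟧
    f : ∣ ⟦ L₁ ⟧ ∣ → ∣ ⟦ L₂ ⟧ ∣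
    f = from₂ ∘ map ∘ to₁
    lt : ∀ x y → piece (to₁ x) K.≤ piece (to₁ y) → piece (to₁ x) ≢ piece (to₁ y) → to₁ x <₁ to₁ y
    lt x y x≤y x≢y with S₁.compare (to₁ x) (to₁ y)
    ... | tri< x<y _ _ = x<y
    ... | tri≈ _ x≡y _ = contradiction (cong piece x≡y) x≢y
    ... | tri> _ _ y<x = contradiction (K.antisym x≤y (piece-mono y<x)) x≢y
    gt : ∀ k k′ →
         Pairwise (TotalOrderProperties._<_ ⟦ L₁ ⟧) (λ l → piece (to₁ l) ≡ k) (λ l → piece (to₁ l) ≡ k′) →
         TotalOrderProperties._<_ ⟦ K ⟧ k k′
    gt k k′ below with onto k | onto k′
    ... | x , refl | y , refl =
      piece-mono (pairwise refl refl) , λ eq → S₁.irrefl refl (pairwise refl eq)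
      where
      pairwise : ∀ {x y} → piece x ≡ k → piece y ≡ k′ → x <₁ y
      pairwise {x} {y} p q = subst₂ _<₁_ (to-from₁ x) (to-from₁ y) (<ᴸ⇒< C↔ℕ sto₁
        (below {from₁ x} {from₁ y} (trans (cong piece (to-from₁ x)) p) (trans (cong piece (to-from₁ y)) q)))
    conv : ∀ k → Convex ⟦ L₂ ⟧ (Image f (λ l → piece (to₁ l) ≡ k))
    conv k {y = w} x≤w w≤z (x , refl , refl) (z , z∈ , refl)
      with S₂.compare (map (to₁ x)) (to₂ w) | S₂.compare (to₂ w) (map (to₁ z))
    ... | tri≈ _ x≡w _ | _ = x , refl , trans (cong from₂ x≡w) (from-to₂ w)
    ... | _ | tri≈ _ w≡z _ = z , z∈ , trans (cong from₂ (sym w≡z)) (from-to₂ w)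
    ... | tri> _ _ w<x | _ = contradiction (subst (_ <₂_) (sym (to-from₂ _)) w<x) (≤⇒≮ D↔ℕ sto₂ (f x) w x≤w)
    ... | _ | tri> _ _ z<w = contradiction (subst (_<₂ _) (sym (to-from₂ _)) z<w) (≤⇒≮ D↔ℕ sto₂ w (f z) w≤z)
    ... | tri< x<w _ _ | tri< w<z _ _ with y , y∈ , fy≡w ← convex (sym z∈) x<w w<z =
      from₁ y , trans (cong piece (to-from₁ y)) y∈ ,
      trans (cong (from₂ ∘ map) (to-from₁ y)) (trans (cong from₂ fy≡w) (from-to₂ w))

-- A bounded monotone map π into ℕ partitions its domain into finitely many
-- pieces, indexed by the image of π.
module _ (em : ExcludedMiddle 0ℓ) {C : Set} (c₀ : C)
         (π : C → ℕ) (b : ℕ) (π<b : ∀ c → π c ℕ.< b) where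

  private
    Hit : ℕ → Set
    Hit n = ∃[ c ] π c ≡ n

    -- The order of ℕ restricted to the image of π.
    LE : ℕ → ℕ → Set
    LE m n = Hit m × Hit n × m ℕ.≤ n

    imageCode : Code
    imageCode (m , n) = isYes (em {LE m n})

    intro : ∀ {m n} → LE m n → T (imageCode (m , n))
    intro = fromWitness {a? = em}

    elim : ∀ {m n} → T (imageCode (m , n)) → LE m n
    elim = toWitness {a? = em}

    total : (k l : Dom imageCode) → order imageCode k l ⊎ order imageCode l k
    total (m , m∈) (n , n∈) with ℕ.≤-total m n | elim m∈ | elim n∈
    ... | inj₁ m≤n | hitₘ , _ | hitₙ , _ = inj₁ (intro (hitₘ , hitₙ , m≤n))
    ... | inj₂ n≤m | hitₘ , _ | hitₙ , _ = inj₂ (intro (hitₙ , hitₘ , n≤m))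

    hit : ∀ c → T (imageCode (π c , π c))
    hit c = intro ((c , refl) , (c , refl) , ℕ.≤-refl)

    image-finite : FiniteDom imageCode
    image-finite = b , λ n n∈ → bounded (elim n∈)
      where
      bounded : ∀ {n} → LE n n → n ℕ.< b
      bounded ((c , refl) , _) = π<b c

    image : Lin
    image = record
      { code         = imageCode
      ; supported    = λ m≤n → support (elim m≤n)
      ; isTotalOrder = record
        { isPartialOrder = record
          { isPreorder = record
            { isEquivalence = isEquivalence
            ; reflexive     = λ { {_ , m∈} refl → m∈ }
            ; trans         = λ k≤l l≤m → trans′ (elim k≤l) (elim l≤m)
            }
          ; antisym = λ k≤l l≤k → ≡-Dom imageCode
                        (ℕ.≤-antisym (proj₂ (proj₂ (elim k≤l))) (proj₂ (proj₂ (elim l≤k))))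
          }
        ; total = total
        }
      ; nonempty     = π c₀ , hit c₀
      ; finOrFull    = inj₁ image-finite
      }
      where
      support : ∀ {m n} → LE m n → T (imageCode (m , m)) × T (imageCode (n , n))
      support ((c , refl) , (d , refl) , _) = hit c , hit d
      trans′ : ∀ {k l m} → LE k l → LE l m → T (imageCode (k , m))
      trans′ (k∈ , _ , k≤l) (_ , m∈ , l≤m) = intro (k∈ , m∈ , ℕ.≤-trans k≤l l≤m)

  finitePiecewise⇒⊴ :
    ∀ {ℓ} {𝓛 : Pred Lin ℓ} → Finite ⊆ 𝓛 →
    {D : Set} (C↔ℕ : C ↔ ℕ) (D↔ℕ : D ↔ ℕ) {_<₁_ : Rel C 0ℓ} {_<₂_ : Rel D 0ℓ}
    (sto₁ : IsStrictTotalOrder _≡_ _<₁_) (sto₂ : IsStrictTotalOrder _≡_ _<₂_) →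
    (∀ {x y} → x <₁ y → π x ℕ.≤ π y) →
    (f : C → D) → (∀ {x y} → x <₁ y → f x <₂ f y) →
    (∀ {x z w} → π x ≡ π z → f x <₂ w → w <₂ f z → ∃[ y ] π y ≡ π x × f y ≡ w) →
    lin C↔ℕ sto₁ ⊴[ 𝓛 ] lin D↔ℕ sto₂
  finitePiecewise⇒⊴ fin C↔ℕ D↔ℕ sto₁ sto₂ π-mono f f-mono f-convex =
    piecewise⇒⊴ C↔ℕ D↔ℕ sto₁ sto₂ {K = image} (fin {image} image-finite)
      record
        { piece      = λ c → π c , hit c
        ; piece-mono = λ x<y → intro ((_ , refl) , (_ , refl) , π-mono x<y)
        ; map        = f
        ; map-mono   = f-mono
        ; convex     = λ eq x<w w<z → conv (f-convex (cong proj₁ eq) x<w w<z)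
        }
      (λ (n , n∈) → onto (elim n∈))
    where
      conv : ∀ {x w} → ∃[ y ] π y ≡ π x × f y ≡ w → ∃[ y ] (π y , hit y) ≡ (π x , hit x) × f y ≡ w
      conv (y , eq , fy) = y , ≡-Dom imageCode eq , fy
      onto : ∀ {n n∈} → LE n n → ∃[ c ] (π c , hit c) ≡ (n , n∈)
      onto ((c , refl) , _) = c , ≡-Dom imageCode refl

-- Sums of rational sequences of finite chains

pullback : {A B : Set} {_≈_ _<_ : Rel B 0ℓ} (f : A → B) → (∀ {x y} → f x ≈ f y → x ≡ y) →
           IsStrictTotalOrder _≈_ _<_ → IsStrictTotalOrder _≡_ (_<_ on f)
pullback {_≈_ = _≈_} {_<_} f f-injective sto = record
  { isStrictPartialOrder = record
    { isEquivalence = isEquivalence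
    ; irrefl        = λ { refl → S.irrefl S.Eq.refl }
    ; trans         = S.trans
    ; <-resp-≈      = (λ { refl x<y → x<y }) , (λ { refl x<y → x<y })
    }
  ; compare = compare
  }
  where
  module S = IsStrictTotalOrder sto
  compare : ∀ x y → Tri (f x < f y) (x ≡ y) (f y < f x)
  compare x y with S.compare (f x) (f y)
  ... | tri< x<y x≉y y≮x = tri< x<y (λ { refl → x≉y S.Eq.refl }) y≮x
  ... | tri≈ x≮y x≈y y≮x = tri≈ x≮y (f-injective x≈y) y≮x
  ... | tri> x≮y x≉y y<x = tri> x≮y (λ { refl → x≉y S.Eq.refl }) y<x

∃< : ∀ q → ∃[ p ] p ℚ.< q
∃< q = q ℚ.- 1ℚ , subst (q ℚ.- 1ℚ ℚ.<_) (ℚ.+-identityʳ q) (ℚ.+-monoʳ-< q (ℚ.negative⁻¹ (ℚ.- 1ℚ)))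

∃> : ∀ q → ∃[ p ] q ℚ.< p
∃> q = q ℚ.+ 1ℚ , subst (ℚ._< q ℚ.+ 1ℚ) (ℚ.+-identityʳ q) (ℚ.+-monoʳ-< q (ℚ.positive⁻¹ 1ℚ))

-- The immediate successor relation.
Covers : {C : Set} → Rel C 0ℓ → Rel C 0ℓ
Covers _<_ x y = x < y × (∀ z → x < z → ¬ (z < y))

-- The sum, over an order on X, of the columns ℚ × (weight x + 1): the column
-- at x is a rational sequence of chains with weight x + 1 elements.
module Blocks {X : Set} (weight : X → ℕ) where

  record Point : Set where
    constructor point
    field
      column   : X
      position : ℚ
      level    : ℕ
      level≤   : level ℕ.≤ weight column

  open Point public

  point-≡ : ∀ {x y : Point} → column x ≡ column y → position x ≡ position y → level x ≡ level y → x ≡ y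
  point-≡ {point x s j p} {point .x .s .j q} refl refl refl = cong (point x s j) (ℕ.≤-irrelevant p q)

  module Order (_<_ : Rel X 0ℓ) (sto : IsStrictTotalOrder _≡_ _<_) where

    infix 4 _≺_
    _≺_ : Rel Point 0ℓ
    _≺_ = ×-Lex _≡_ _<_ (×-Lex _≡_ ℚ._<_ ℕ._<_) on λ x → column x , position x , level x

    ≺-isStrictTotalOrder : IsStrictTotalOrder _≡_ _≺_
    ≺-isStrictTotalOrder = pullback _ (λ (c , p , l) → point-≡ c p l)
      (×-isStrictTotalOrder sto (×-isStrictTotalOrder ℚ.<-isStrictTotalOrder ℕ.<-isStrictTotalOrder))

    open StrictOrder ≺-isStrictTotalOrder

    -- The bottom of a chain is not an immediate successor, and the top of a
    -- chain has no immediate successor.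
    bottom-gap : ∀ {x} w → level x ≡ 0 → w ≺ x → ∃[ z ] w ≺ z × z ≺ x
    bottom-gap {x} w lev (inj₁ w<x) with u , u<x ← ∃< (position x) =
      point (column x) u 0 z≤n , inj₁ w<x , inj₂ (refl , inj₁ u<x)
    bottom-gap {x} w lev (inj₂ (refl , inj₁ w<x)) with u , w<u , u<x ← ℚ.<-dense w<x =
      point (column x) u 0 z≤n , inj₂ (refl , inj₁ w<u) , inj₂ (refl , inj₁ u<x)
    bottom-gap {x} w lev (inj₂ (refl , inj₂ (refl , l<))) = contradiction (subst (_ ℕ.<_) lev l<) λ ()

    top-gap : ∀ {x} w → level x ≡ weight (column x) → x ≺ w → ∃[ z ] x ≺ z × z ≺ w
    top-gap {x} w lev (inj₁ x<w) with u , x<u ← ∃> (position x) =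
      point (column x) u 0 z≤n , inj₂ (refl , inj₁ x<u) , inj₁ x<w
    top-gap {x} w lev (inj₂ (refl , inj₁ x<w)) with u , x<u , u<w ← ℚ.<-dense x<w =
      point (column x) u 0 z≤n , inj₂ (refl , inj₁ x<u) , inj₂ (refl , inj₁ u<w)
    top-gap {x} w lev (inj₂ (refl , inj₂ (refl , l<))) =
      contradiction (subst (ℕ._< _) lev (ℕ.≤-trans l< (level≤ w))) (ℕ.<-irrefl refl)

    level-covers : ∀ {c s j} p q → Covers _≺_ (point c s j p) (point c s (suc j) q)
    level-covers p q = inj₂ (refl , inj₂ (refl , ℕ.≤-refl)) , λ
      { z (inj₁ c<z) (inj₁ z<c) → IsStrictTotalOrder.asym sto c<z z<c
      ; z (inj₁ c<z) (inj₂ (refl , _)) → IsStrictTotalOrder.irrefl sto refl c<z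
      ; z (inj₂ (refl , _)) (inj₁ z<c) → IsStrictTotalOrder.irrefl sto refl z<c
      ; z (inj₂ (refl , inj₁ s<z)) (inj₂ (_ , inj₁ z<s)) → ℚ.<-asym s<z z<s
      ; z (inj₂ (refl , inj₁ s<z)) (inj₂ (_ , inj₂ (refl , _))) → ℚ.<-irrefl refl s<z
      ; z (inj₂ (refl , inj₂ (refl , _))) (inj₂ (_ , inj₁ z<s)) → ℚ.<-irrefl refl z<s
      ; z (inj₂ (refl , inj₂ (refl , j<z))) (inj₂ (_ , inj₂ (_ , z<sj))) → ℕ.<-irrefl refl (ℕ.≤-trans z<sj j<z)
      }

    -- Immediate successors exist only inside a chain.
    covers-level : ∀ {x y} → Covers _≺_ x y → level y ≡ suc (level x)
    covers-level {x} {y} (x<y , no-between) with ℕ.m≤n⇒m<n∨m≡n (level≤ x)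
    ... | inj₂ lev with z , x<z , z<y ← top-gap {x} y lev x<y = contradiction z<y (no-between z x<z)
    ... | inj₁ l<w with compare y (point (column x) (position x) (suc (level x)) l<w)
    ...   | tri< y<s _ _  = contradiction y<s
              (proj₂ (level-covers {column x} {position x} (level≤ x) l<w) y x<y)
    ...   | tri≈ _ refl _ = refl
    ...   | tri> _ _ s<y  = contradiction s<y
              (no-between (point (column x) (position x) (suc (level x)) l<w)
                (proj₁ (level-covers {column x} {position x} (level≤ x) l<w)))

module _ {C D : Set} {_<₁_ : Rel C 0ℓ} {_<₂_ : Rel D 0ℓ}
         (sto₁ : IsStrictTotalOrder _≡_ _<₁_) (sto₂ : IsStrictTotalOrder _≡_ _<₂_)
         {K} (e : PiecewiseEmbedding _<₁_ _<₂_ K) where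
  open PiecewiseEmbedding e
  private
    module S₂ = StrictOrder sto₂
    reflects : ∀ {x y} → map x <₂ map y → x <₁ y
    reflects = map-reflects sto₁ sto₂ e

  -- As the image of a piece is convex, the map preserves immediate successors
  -- inside a piece, and an immediate neighbour of an image comes from an
  -- immediate neighbour, provided that the piece extends in its direction.
  map-covers : ∀ {x y} → piece x ≡ piece y → Covers _<₁_ x y → Covers _<₂_ (map x) (map y)
  map-covers {x} {y} eq (x<y , no-between) = map-mono x<y , gap
    where
    gap : ∀ w → map x <₂ w → ¬ (w <₂ map y)
    gap w x<w w<y with z , _ , refl ← convex eq x<w w<y =
      no-between z (reflects x<w) (reflects w<y)

  covers-below : ∀ {x y w} → piece x ≡ piece y → x <₁ y → Covers _<₂_ w (map y) →
                 ∃[ z ] Covers _<₁_ z y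
  covers-below {x} {y} {w} eq x<y (w<y , no-between) with S₂.compare (map x) w
  ... | tri≈ _ refl _ = x , x<y , λ z x<z z<y → no-between (map z) (map-mono x<z) (map-mono z<y)
  ... | tri> _ _ w<x = contradiction (map-mono x<y) (no-between (map x) w<x)
  ... | tri< x<w _ _ with v , _ , refl ← convex eq x<w w<y =
    v , reflects w<y , λ z v<z z<y → no-between (map z) (map-mono v<z) (map-mono z<y)

  covers-above : ∀ {x y w} → piece x ≡ piece y → x <₁ y → Covers _<₂_ (map x) w →
                 ∃[ z ] Covers _<₁_ x z
  covers-above {x} {y} {w} eq x<y (x<w , no-between) with S₂.compare w (map y)
  ... | tri≈ _ refl _ = y , x<y , λ z x<z z<y → no-between (map z) (map-mono x<z) (map-mono z<y)
  ... | tri> _ _ y<w = contradiction y<w (no-between (map y) (map-mono x<y))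
  ... | tri< w<y _ _ with v , _ , refl ← convex eq x<w w<y =
    v , reflects x<w , λ z x<z z<v → no-between (map z) (map-mono x<z) (map-mono z<v)

module _ {X Y : Set} (weight₁ : X → ℕ) (weight₂ : Y → ℕ) where
  private
    module B₁ = Blocks weight₁
    module B₂ = Blocks weight₂

  module _ (em : ExcludedMiddle 0ℓ) {_<₁_ : Rel X 0ℓ} {_<₂_ : Rel Y 0ℓ}
           (sto₁ : IsStrictTotalOrder _≡_ _<₁_) (sto₂ : IsStrictTotalOrder _≡_ _<₂_)
           {K : Lin} (scattered : Scat K)
           (e : PiecewiseEmbedding (B₁.Order._≺_ _<₁_ sto₁) (B₂.Order._≺_ _<₂_ sto₂) K) where
    open PiecewiseEmbedding e
    private
      module O₁ = B₁.Order _<₁_ sto₁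
      module O₂ = B₂.Order _<₂_ sto₂
      module K = TotalOrder ⟦ K ⟧
      open B₁ using (Point; column)

      bottom : X → ℚ → Point
      bottom c s = B₁.point c s 0 z≤n

      bottom-mono : ∀ {c s t} → s ℚ.< t → bottom c s O₁.≺ bottom c t
      bottom-mono s<t = inj₂ (refl , inj₁ s<t)

    -- Otherwise the bottoms of the chains of the column would lie in distinct
    -- pieces, and ℚ would embed into K.
    repeated-piece : ∀ c → ∃[ s ] ∃[ t ] s ℚ.< t × piece (bottom c s) ≡ piece (bottom c t)
    repeated-piece c with em {∃[ s ] ∃[ t ] s ℚ.< t × piece (bottom c s) ≡ piece (bottom c t)}
    ... | yes found = found
    ... | no  none  = contradiction (g , record
      { isOrderHomomorphism = record { cong = cong g ; mono = g-mono }
      ; injective = λ {s} {t} → inj s t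
      ; cancel    = λ {s} {t} → cancel s t
      }) scattered
      where
      g : ℚ → ∣ ⟦ K ⟧ ∣
      g s = piece (bottom c s)
      inj : ∀ s t → g s ≡ g t → s ≡ t
      inj s t eq with ℚ.<-cmp s t
      ... | tri< s<t _ _ = contradiction (s , t , s<t , eq) none
      ... | tri≈ _ s≡t _ = s≡t
      ... | tri> _ _ t<s = contradiction (t , s , t<s , sym eq) none
      g-mono : ∀ {s t} → s ℚ.≤ t → g s K.≤ g t
      g-mono {s} {t} s≤t with ℚ.<-cmp s t
      ... | tri< s<t _ _ = piece-mono (bottom-mono s<t)
      ... | tri≈ _ refl _ = K.refl {g s}
      ... | tri> _ _ t<s = contradiction (ℚ.<-≤-trans t<s s≤t) (ℚ.<-irrefl {t} refl)
      cancel : ∀ s t → g s K.≤ g t → s ℚ.≤ t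
      cancel s t gs≤gt with ℚ.<-cmp s t
      ... | tri< s<t _ _ = ℚ.<⇒≤ s<t
      ... | tri≈ _ refl _ = ℚ.≤-refl
      ... | tri> _ _ t<s = ℚ.≤-reflexive (inj s t (K.antisym gs≤gt (piece-mono (bottom-mono t<s))))

    -- A chain strictly between two points of a piece goes onto a chain: its
    -- bottom goes to a bottom and its top to a top, since otherwise the image,
    -- and therefore the point itself, would have an immediate neighbour outside
    -- the chain.  So some point of each column goes to a column of the same weight.
    weight-preserved : ∀ c → ∃[ x ] column x ≡ c × weight₂ (B₂.column (map x)) ≡ weight₁ c
    weight-preserved c with s , t , s<t , eq ← repeated-piece c
      with u , s<u , u<t ← ℚ.<-dense s<t = chain (weight₁ c) ℕ.≤-refl , refl , image-weight
      where
      chain : ∀ j → j ℕ.≤ weight₁ c → Point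
      chain j j≤w = B₁.point c u j j≤w

      above : ∀ j j≤w → bottom c s O₁.≺ chain j j≤w
      above _ _ = inj₂ (refl , inj₁ s<u)
      below : ∀ j j≤w → chain j j≤w O₁.≺ bottom c t
      below _ _ = inj₂ (refl , inj₁ u<t)

      same-piece : ∀ j j≤w → piece (bottom c s) ≡ piece (chain j j≤w)
      same-piece j j≤w = K.antisym {piece (bottom c s)} {piece (chain j j≤w)} (piece-mono (above j j≤w))
        (subst (piece (chain j j≤w) K.≤_) (sym eq) (piece-mono (below j j≤w)))

      image-level : ∀ j j≤w → B₂.level (map (chain j j≤w)) ≡ j
      image-level zero z≤n with B₂.level (map (bottom c u)) in lev
      ... | zero  = refl
      ... | suc l = contradiction
              (covers-below O₁.≺-isStrictTotalOrder O₂.≺-isStrictTotalOrder e {bottom c s} {bottom c u} {w}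
                (same-piece 0 z≤n) (above 0 z≤n) covered)
              λ (z , z<u , no-between) →
                let y , z<y , y<u = O₁.bottom-gap {bottom c u} z refl z<u in no-between y z<y y<u
        where
        v : B₂.Point
        v = map (bottom c u)
        l<w : suc l ℕ.≤ weight₂ (B₂.column v)
        l<w = subst (ℕ._≤ weight₂ (B₂.column v)) lev (B₂.level≤ v)
        w = B₂.point (B₂.column v) (B₂.position v) l (ℕ.<⇒≤ l<w)
        covered : Covers O₂._≺_ w v
        covered = subst (λ v → Covers O₂._≺_ w v)
          (B₂.point-≡ {B₂.point (B₂.column v) (B₂.position v) (suc l) l<w} {v} refl refl (sym lev))
          (O₂.level-covers {B₂.column v} {B₂.position v} (ℕ.<⇒≤ l<w) l<w)
      image-level (suc j) j<w = trans
        (O₂.covers-level {map (chain j j≤w)} {map (chain (suc j) j<w)}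
          (map-covers O₁.≺-isStrictTotalOrder O₂.≺-isStrictTotalOrder e {chain j j≤w} {chain (suc j) j<w}
          (trans (sym (same-piece j j≤w)) (same-piece (suc j) j<w)) (O₁.level-covers j≤w j<w)))
        (cong suc (image-level j j≤w))
        where j≤w = ℕ.<⇒≤ j<w

      top = chain (weight₁ c) ℕ.≤-refl

      image-weight : weight₂ (B₂.column (map top)) ≡ weight₁ c
      image-weight with ℕ.m≤n⇒m<n∨m≡n (B₂.level≤ (map top))
      ... | inj₂ lev = trans (sym lev) (image-level _ ℕ.≤-refl)
      ... | inj₁ l<w = contradiction
              (covers-above O₁.≺-isStrictTotalOrder O₂.≺-isStrictTotalOrder e {top} {bottom c t} {w}
                (trans (sym (same-piece _ ℕ.≤-refl)) eq) (below _ ℕ.≤-refl)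
                (O₂.level-covers {B₂.column (map top)} {B₂.position (map top)} (B₂.level≤ (map top)) l<w))
              λ (z , u<z , no-between) →
                let y , u<y , y<z = O₁.top-gap {top} z refl u<z in no-between y u<y y<z
        where
        w = B₂.point (B₂.column (map top)) (B₂.position (map top)) (suc (B₂.level (map top))) l<w

-- The order attached to a sequence of reals

-- A nonincreasing list of exponents stands for an ordinal below ω^ω in Cantor
-- normal form, and the lexicographic order of such lists is the order of the
-- ordinals.  The relation i ◂ α says that α is such a list, that it is not
-- empty, and that its last exponent exceeds i.
infix 4 _◂_
data _◂_ (i : ℕ) : List ℕ → Set where
  last : ∀ {a} → i ℕ.< a → i ◂ a ∷ []
  more : ∀ {a b l} → b ℕ.≤ a → i ◂ b ∷ l → i ◂ a ∷ b ∷ l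

◂-irrelevant : ∀ {i α} (u v : i ◂ α) → u ≡ v
◂-irrelevant (last p)   (last q)   = cong last (ℕ.≤-irrelevant p q)
◂-irrelevant (more p u) (more q v) = cong₂ more (ℕ.≤-irrelevant p q) (◂-irrelevant u v)

◂⇒<head : ∀ {i a l} → i ◂ a ∷ l → i ℕ.< a
◂⇒<head (last i<a)   = i<a
◂⇒<head (more b≤a v) = ℕ.≤-trans (◂⇒<head v) b≤a

infix 4 _<ₗ_
_<ₗ_ : Rel (List ℕ) 0ℓ
_<ₗ_ = Lex-< _≡_ ℕ._<_

<ₗ-isStrictTotalOrder : IsStrictTotalOrder _≡_ _<ₗ_
<ₗ-isStrictTotalOrder = pullback id Pointwise-≡⇒≡ (List.<-isStrictTotalOrder ℕ.<-isStrictTotalOrder)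

-- The columns of the order attached to a sequence.  The type does not depend on
-- the sequence, which affects only how the left columns are ordered.
data Column : Set where
  left : ℕ → ℚ → Column
  room : ∀ α i → i ◂ α → Bool → ℚ → Column

-- Columns are compared by their keys (α , i , b , q), lexicographically and with
-- the second component reversed.  Left columns have the empty list as α and come
-- before the room, because no i satisfies i ◂ [].
Key : Set
Key = List ℕ × ℕ × Bool × ℚ

-- The arrangement of the rationals, each marked with a Boolean, that puts those
-- marked false first.
Side : Rel (Bool × ℚ) 0ℓ
Side = ×-Lex _≡_ Bool._<_ ℚ._<_

infix 4 _<ₖ_
_<ₖ_ : Rel Key 0ℓ
_<ₖ_ = ×-Lex _≡_ _<ₗ_ (×-Lex _≡_ ℕ._>_ Side)

>-isStrictTotalOrder : IsStrictTotalOrder _≡_ ℕ._>_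
>-isStrictTotalOrder = pullback id sym (Flip.isStrictTotalOrder ℕ.<-isStrictTotalOrder)

-- The argument β is the sequence of cuts: β i q says whether q is below the real
-- with index i.
key : (ℕ → ℚ → Bool) → Column → Key
key β (left i q)       = [] , i , β i q , q
key β (room α i _ b q) = α  , i , b     , q

key-injective : ∀ β {c d} → key β c ≡ key β d → c ≡ d
key-injective β {left i q}       {left .i .q}         refl = refl
key-injective β {room α i u b q} {room .α .i v .b .q} refl =
  cong (λ v → room α i v b q) (◂-irrelevant u v)
key-injective β {left i q}         {room .[] .i () _ _} refl
key-injective β {room .[] i () b q} {left .i .q}         refl

label : Column → ℕ × ℚ
label (left i q)       = i , q
label (room _ i _ _ q) = i , q

labelWeight : ℕ × ℚ → ℕ
labelWeight (i , q) = pair i (encodeℚ q)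

weight : Column → ℕ
weight c = labelWeight (label c)

weight-injective : ∀ c d → weight c ≡ weight d → label c ≡ label d
weight-injective c d eq
  with i≡j , q≡r ← pair-injective (proj₁ (label c)) (proj₁ (label d)) eq =
  cong₂ _,_ i≡j (encodeℚ-injective q≡r)

open Blocks weight

encodeBool : Bool → ℕ
encodeBool false = 0
encodeBool true  = 1

encodeBool-injective : Injective _≡_ _≡_ encodeBool
encodeBool-injective {false} {false} _ = refl
encodeBool-injective {true}  {true}  _ = refl

encodeColumn : Column → ℕ
encodeColumn (left i q)       = pair 0 (pair i (encodeℚ q))
encodeColumn (room α i _ b q) =
  pair 1 (pair (encodeList α) (pair i (pair (encodeBool b) (encodeℚ q))))

encodeColumn-injective : ∀ c d → encodeColumn c ≡ encodeColumn d → c ≡ d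
encodeColumn-injective (left i q) (left j r) eq
  with e ← proj₂ (pair-injective 0 0 eq)
  with i≡j , q≡r ← pair-injective i j e = cong₂ left i≡j (encodeℚ-injective q≡r)
encodeColumn-injective (left i q) (room α j v b r) eq =
  contradiction (proj₁ (pair-injective 0 1 {pair i (encodeℚ q)} eq)) λ ()
encodeColumn-injective (room α i u b q) (left j r) eq =
  contradiction (proj₁ (pair-injective 1 0 {_} {pair j (encodeℚ r)} eq)) λ ()
encodeColumn-injective (room α i u b q) (room α′ j v b′ r) eq
  with e₁ ← proj₂ (pair-injective 1 1 eq)
  with α≡ , e₂ ← pair-injective (encodeList α) (encodeList α′) e₁
  with i≡ , e₃ ← pair-injective i j e₂
  with b≡ , q≡ ← pair-injective (encodeBool b) (encodeBool b′) e₃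
  with encodeList-injective {α} {α′} α≡ | i≡ | encodeBool-injective {b} {b′} b≡
     | encodeℚ-injective {q} {r} q≡
... | refl | refl | refl | refl = cong (λ v → room α i v b q) (◂-irrelevant u v)

encodePoint : Point → ℕ
encodePoint x = pair (encodeColumn (column x)) (pair (encodeℚ (position x)) (level x))

encodePoint-injective : Injective _≡_ _≡_ encodePoint
encodePoint-injective {x} {y} eq
  with c≡ , e ← pair-injective (encodeColumn (column x)) (encodeColumn (column y)) eq
  with s≡ , l≡ ← pair-injective (encodeℚ (position x)) (encodeℚ (position y)) e =
  point-≡ (encodeColumn-injective _ _ c≡) (encodeℚ-injective s≡) l≡

encodePoint-unbounded : ∀ n → ∃[ x ] n ℕ.≤ encodePoint x
encodePoint-unbounded n = point (left n 0ℚ) 0ℚ 0 z≤n ,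
  ℕ.≤-trans (m≤pair n (encodeℚ 0ℚ))
    (ℕ.≤-trans (n≤pair 0 (pair n (encodeℚ 0ℚ))) (m≤pair (encodeColumn (left n 0ℚ)) _))

module SequenceOrder (β : ℕ → ℚ → Bool) where
  infix 4 _<_
  _<_ : Rel Column 0ℓ
  _<_ = _<ₖ_ on key β

  isStrictTotalOrder : IsStrictTotalOrder _≡_ _<_
  isStrictTotalOrder = pullback (key β)
    (λ { (α≡ , i≡ , b≡ , q≡) → key-injective β (cong₂ _,_ α≡ (cong₂ _,_ i≡ (cong₂ _,_ b≡ q≡))) })
    (×-isStrictTotalOrder <ₗ-isStrictTotalOrder (×-isStrictTotalOrder >-isStrictTotalOrder
      (×-isStrictTotalOrder Bool.<-isStrictTotalOrder ℚ.<-isStrictTotalOrder)))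

  open Order _<_ isStrictTotalOrder public using (_≺_; ≺-isStrictTotalOrder)

module _ (em : ExcludedMiddle 0ℓ) where

  -- Only the fact that this is a bijection matters.
  abstract
    pointEnumeration : Point ↔ ℕ
    pointEnumeration = enumerate em encodePoint encodePoint-injective encodePoint-unbounded

  -- The order attached to the sequence of cuts β, carried over to ℕ.
  orderOf : (ℕ → ℚ → Bool) → Lin
  orderOf β = lin pointEnumeration (SequenceOrder.≺-isStrictTotalOrder β)

-- Embedding into an order with finitely many different coordinates

key-squeeze : ∀ {α i b p r} k → (α , i , b , p) <ₖ k → k <ₖ (α , i , b , r) →
              ∃[ q ] k ≡ (α , i , b , q) × p ℚ.< q × q ℚ.< r
key-squeeze k (inj₁ α<k)         (inj₁ k<α)       =
  contradiction k<α (IsStrictTotalOrder.asym <ₗ-isStrictTotalOrder α<k)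
key-squeeze k (inj₁ α<k)         (inj₂ (k≡α , _)) =
  contradiction α<k (IsStrictTotalOrder.irrefl <ₗ-isStrictTotalOrder (sym k≡α))
key-squeeze k (inj₂ (α≡k , _))   (inj₁ k<α)       =
  contradiction k<α (IsStrictTotalOrder.irrefl <ₗ-isStrictTotalOrder (sym α≡k))
key-squeeze k (inj₂ (refl , u))  (inj₂ (_ , v)) with u | v
... | inj₁ i>k          | inj₁ k>i          = contradiction k>i (ℕ.<-asym i>k)
... | inj₁ i>k          | inj₂ (refl , _)   = contradiction i>k (ℕ.<-irrefl refl)
... | inj₂ (refl , _)   | inj₁ k>i          = contradiction k>i (ℕ.<-irrefl refl)
... | inj₂ (refl , inj₁ f<t)           | inj₂ (_ , inj₁ ())
... | inj₂ (refl , inj₂ (refl , p<q))  | inj₂ (_ , inj₂ (_ , q<r)) = _ , refl , p<q , q<r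

double-mono : ∀ {m n} → m ℕ.≤ n → double m ℕ.≤ double n
double-mono z≤n       = z≤n
double-mono (s≤s m≤n) = s≤s (s≤s (double-mono m≤n))

-- The number 2 n + b.
append : ℕ → Bool → ℕ
append n false = double n
append n true  = suc (double n)

append-injective : ∀ {m n} a b → append m a ≡ append n b → m ≡ n × a ≡ b
append-injective false false eq = double-injective eq , refl
append-injective false true  eq = contradiction eq (double≢suc-double _ _)
append-injective true  false eq = contradiction (sym eq) (double≢suc-double _ _)
append-injective true  true  eq = double-injective (ℕ.suc-injective eq) , refl

append-< : ∀ {m n} a b → m ℕ.< n → append m a ℕ.≤ append n b
append-< {m} {n} a b m<n = ℕ.≤-trans (upper a) (ℕ.≤-trans (double-mono m<n) (lower′ b))
  where
  upper : ∀ a → append m a ℕ.≤ double (suc m)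
  upper false = ℕ.m≤n⇒m≤1+n (ℕ.n≤1+n _)
  upper true  = ℕ.n≤1+n _
  lower′ : ∀ b → double n ℕ.≤ append n b
  lower′ false = ℕ.≤-refl
  lower′ true  = ℕ.n≤1+n _

-- The embedding of the order of β into that of γ, when these agree from m
-- onwards and each β i is a lower set.
module Absorb (β γ : ℕ → ℚ → Bool) (m : ℕ)
              (agree : ∀ n → m ℕ.≤ n → ∀ q → β n q ≡ γ n q)
              (downward : ∀ i {p q} → p ℚ.< q → T (β i q) → T (β i p)) where
  private
    module β = SequenceOrder β
    module γ = SequenceOrder γ

  -- Left addition of the ordinal ω^m, except that 0 goes to 0: leading exponents
  -- above m absorb it.
  shift : List ℕ → List ℕ
  shift []      = []
  shift (a ∷ l) with a ℕ.≤? m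
  ... | yes _ = m ∷ a ∷ l
  ... | no  _ = a ∷ l

  shift-◂ : ∀ {i α} → i ◂ α → i ◂ shift α
  shift-◂ {α = a ∷ l} v with a ℕ.≤? m
  ... | yes a≤m = more a≤m v
  ... | no  _   = v

  shift-mono : ∀ {a l b k} → a ∷ l <ₗ b ∷ k → shift (a ∷ l) <ₗ shift (b ∷ k)
  shift-mono {a} {l} {b} {k} lt with a ℕ.≤? m | b ℕ.≤? m
  shift-mono lt          | yes _   | yes _   = next refl lt
  shift-mono lt          | yes _   | no  b≰m = this (ℕ.≰⇒> b≰m)
  shift-mono (this a<b)  | no  a≰m | yes b≤m = contradiction (ℕ.≤-trans (ℕ.<⇒≤ a<b) b≤m) a≰m
  shift-mono (next refl _) | no a≰m | yes b≤m = contradiction b≤m a≰m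
  shift-mono lt          | no  _   | no  _   = lt

  [m]<shift : ∀ a l → m ∷ [] <ₗ shift (a ∷ l)
  [m]<shift a l with a ℕ.≤? m
  ... | yes _   = next refl halt
  ... | no  a≰m = this (ℕ.≰⇒> a≰m)

  []<shift : ∀ a l → [] <ₗ shift (a ∷ l)
  []<shift a l with a ℕ.≤? m
  ... | yes _ = halt
  ... | no  _ = halt

  -- The list m ∷ [] itself is not needed: its columns receive the left columns
  -- with i below m.
  shift-onto : ∀ {i α} → i ◂ α → m ∷ [] <ₗ α → ∃[ α′ ] i ◂ α′ × shift α′ ≡ α
  shift-onto {α = a ∷ l} v (this m<a) = a ∷ l , v , eq
    where
    eq : shift (a ∷ l) ≡ a ∷ l
    eq with a ℕ.≤? m
    ... | yes a≤m = contradiction a≤m (ℕ.<⇒≱ m<a)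
    ... | no  _   = refl
  shift-onto (more {b = b} {l} b≤m v) (next refl halt) = b ∷ l , v , eq
    where
    eq : shift (b ∷ l) ≡ m ∷ b ∷ l
    eq with b ℕ.≤? m
    ... | yes _   = refl
    ... | no  b≰m = contradiction b≤m b≰m

  -- The effect of the embedding on keys: only the list changes.
  moveIndex : List ℕ → ℕ → List ℕ
  moveIndex [] i with i ℕ.<? m
  ... | yes _ = m ∷ []
  ... | no  _ = []
  moveIndex (a ∷ l) i = shift (a ∷ l)

  -- The left half (i , b) with i below m goes to the half (i , b) at the list
  -- m ∷ [], which has both halves in full.
  move : Column → Column
  move (left i q) with i ℕ.<? m
  ... | yes i<m = room (m ∷ []) i (last i<m) (β i q) q
  ... | no  _   = left i q
  move (room α i v b q) = room (shift α) i (shift-◂ v) b q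

  key-move : ∀ c → let (α , i , u) = key β c in key γ (move c) ≡ (moveIndex α i , i , u)
  key-move (left i q) with i ℕ.<? m
  ... | yes _   = refl
  ... | no  i≮m = cong (λ b → [] , i , b , q) (sym (agree i (ℕ.≮⇒≥ i≮m) q))
  key-move (room (a ∷ l) i v b q) = refl

  label-move : ∀ c → label (move c) ≡ label c
  label-move (left i q) with i ℕ.<? m
  ... | yes _ = refl
  ... | no  _ = refl
  label-move (room _ _ _ _ _) = refl

  moveIndex-mono : ∀ {α α′} i i′ → α <ₗ α′ → moveIndex α i <ₗ moveIndex α′ i′
  moveIndex-mono {[]} {a ∷ l} i i′ halt with i ℕ.<? m
  ... | yes _ = [m]<shift a l
  ... | no  _ = []<shift a l
  moveIndex-mono {_ ∷ _} {_ ∷ _} i i′ lt = shift-mono lt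

  moveIndex-anti : ∀ α {i i′} → i′ ℕ.< i → moveIndex α i <ₗ moveIndex α i′ ⊎ moveIndex α i ≡ moveIndex α i′
  moveIndex-anti []      {i} {i′} i′<i with i ℕ.<? m | i′ ℕ.<? m
  ... | yes _   | yes _    = inj₂ refl
  ... | yes i<m | no  i′≮m = contradiction (ℕ.<-trans i′<i i<m) i′≮m
  ... | no  _   | yes _    = inj₁ halt
  ... | no  _   | no  _    = inj₂ refl
  moveIndex-anti (a ∷ l) i′<i = inj₂ refl

  moveKey-mono : ∀ {α i u α′ i′ u′} → (α , i , u) <ₖ (α′ , i′ , u′) →
                 (moveIndex α i , i , u) <ₖ (moveIndex α′ i′ , i′ , u′)
  moveKey-mono (inj₁ α<α′) = inj₁ (moveIndex-mono _ _ α<α′)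
  moveKey-mono {α} (inj₂ (refl , inj₁ i>i′)) with moveIndex-anti α i>i′
  ... | inj₁ lt = inj₁ lt
  ... | inj₂ eq = inj₂ (eq , inj₁ i>i′)
  moveKey-mono (inj₂ (refl , inj₂ (refl , u<u′))) = inj₂ (refl , inj₂ (refl , u<u′))

  move-mono : ∀ {c d} → c β.< d → move c γ.< move d
  move-mono {c} {d} c<d = subst₂ _<ₖ_ (sym (key-move c)) (sym (key-move d)) (moveKey-mono c<d)

  -- The number of the piece of a column.  All left columns with i at least m form
  -- the piece 0, and the room is the last piece.  For i below m there is a piece
  -- for each b; its number exceeds 0 since m ∸ i is positive.
  slot : List ℕ → ℕ → Bool → ℕ
  slot [] i b with i ℕ.<? m
  ... | yes _ = append (m ℕ.∸ i) b
  ... | no  _ = 0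
  slot (_ ∷ _) _ _ = append (suc m) false

  slotOf : Key → ℕ
  slotOf (α , i , b , q) = slot α i b

  slot≤ : ∀ α i b → slot α i b ℕ.≤ append (suc m) false
  slot≤ [] i b with i ℕ.<? m
  ... | yes _ = append-< b false (s≤s (ℕ.m∸n≤m m i))
  ... | no  _ = z≤n
  slot≤ (_ ∷ _) i b = ℕ.≤-refl

  slot-mono : ∀ k k′ → k <ₖ k′ → slotOf k ℕ.≤ slotOf k′
  slot-mono (α , i , b , q) (_ ∷ _ , i′ , b′ , q′) (inj₁ lt) = slot≤ α i b
  slot-mono ([] , i , b , q) ([] , i′ , b′ , q′) (inj₁ (base ()))
  slot-mono (_ ∷ _ , i , b , q) (_ , i′ , b′ , q′) (inj₂ (refl , _)) = ℕ.≤-refl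
  slot-mono ([] , i , b , q) (_ , i′ , b′ , q′) (inj₂ (refl , inj₁ i>i′)) with i ℕ.<? m | i′ ℕ.<? m
  ... | yes i<m | yes _    = append-< b b′ (ℕ.∸-monoʳ-< i>i′ (ℕ.<⇒≤ i<m))
  ... | yes i<m | no  i′≮m = contradiction (ℕ.<-trans i>i′ i<m) i′≮m
  ... | no  _   | _        = z≤n
  slot-mono ([] , i , b , q) (_ , _ , b′ , q′) (inj₂ (refl , inj₂ (refl , u))) with i ℕ.<? m
  ... | no  _   = z≤n
  slot-mono ([] , i , false , q) (_ , _ , true , q′) (inj₂ (refl , inj₂ (refl , inj₁ f<t))) | yes _ = ℕ.n≤1+n _
  slot-mono ([] , i , b , q) (_ , _ , _ , q′) (inj₂ (refl , inj₂ (refl , inj₂ (refl , _)))) | yes _ = ℕ.≤-refl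

  pieceOf : Column → ℕ
  pieceOf c = slotOf (key β c)

  fixed : ∀ {i q} → m ℕ.≤ i → pieceOf (left i q) ≡ 0 × move (left i q) ≡ left i q
  fixed {i} m≤i with i ℕ.<? m
  ... | yes i<m = contradiction m≤i (ℕ.<⇒≱ i<m)
  ... | no  _   = refl , refl

  moved : ∀ {i} q → (i<m : i ℕ.< m) → pieceOf (left i q) ≡ append (m ℕ.∸ i) (β i q) ×
          move (left i q) ≡ room (m ∷ []) i (last i<m) (β i q) q
  moved {i} q i<m with i ℕ.<? m
  ... | yes i<m′ = refl , cong (λ v → room (m ∷ []) i v (β i q) q) (◂-irrelevant _ _)
  ... | no  i≮m  = contradiction i<m i≮m

  append-positive : ∀ {n} b → 0 ℕ.< n → 0 ≢ append n b
  append-positive {suc _} false _ ()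
  append-positive {suc _} true _ ()

  -- Both the rationals below a cut and those not below it form convex sets.
  between : ∀ i b {p q r} → β i p ≡ b → β i r ≡ b → p ℚ.< q → q ℚ.< r → β i q ≡ b
  between i true  {q = q} _ r∈ _ q<r with β i q | downward i q<r (subst T (sym r∈) _)
  ... | true | _ = refl
  between i false {q = q} p∉ _ p<q _ with β i q | downward i p<q
  ... | false | _ = refl
  ... | true  | p∈ = ⊥-elim (subst T p∉ (p∈ _))

  move-convex : ∀ c e w → pieceOf c ≡ pieceOf e → move c γ.< w → w γ.< move e →
                ∃[ d ] pieceOf d ≡ pieceOf c × move d ≡ w
  -- The room goes onto the final segment of columns whose list is above m ∷ [].
  move-convex (room (a ∷ l) _ _ _ _) e (left _ _) eq (inj₂ (shift≡[] , _)) w<e =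
    contradiction (subst ([] <ₗ_) shift≡[] ([]<shift a l)) λ { (base ()) }
  move-convex (room (a ∷ l) _ _ _ _) e (left _ _) eq (inj₁ lt) w<e with a ℕ.≤? m
  move-convex (room (a ∷ l) _ _ _ _) e (left _ _) eq (inj₁ ()) w<e | yes _
  move-convex (room (a ∷ l) _ _ _ _) e (left _ _) eq (inj₁ ()) w<e | no _
  move-convex (room (a ∷ l) _ _ _ _) e (room α i v b q) eq c<w w<e
    with shift-onto v (above c<w)
    where
    above : ∀ {i′ u} → (shift (a ∷ l) , i′ , u) <ₖ (α , i , b , q) → m ∷ [] <ₗ α
    above (inj₁ lt)          = IsStrictTotalOrder.trans <ₗ-isStrictTotalOrder ([m]<shift a l) lt
    above (inj₂ (refl , _)) = [m]<shift a l
  ... | a′ ∷ l′ , v′ , refl =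
    room (a′ ∷ l′) i v′ b q , refl , cong (λ v → room _ i v b q) (◂-irrelevant _ _)
  -- The left columns with index at least m are an initial segment of both orders.
  move-convex (left i q) e w eq c<w w<e with i ℕ.<? m
  move-convex (left i q) (room (_ ∷ _) _ _ _ _) w eq c<w w<e | no _ = contradiction eq λ ()
  move-convex (left i q) (left i′ q′) w eq c<w w<e | no i≮m with i′ ℕ.<? m
  ... | yes i′<m = contradiction eq (append-positive (β i′ q′) (ℕ.m<n⇒0<n∸m i′<m))
  move-convex (left i q) (left i′ q′) (room [] _ () _ _) eq c<w w<e | no i≮m | no i′≮m
  move-convex (left i q) (left i′ q′) (room (_ ∷ _) _ _ _ _) eq c<w (inj₁ ()) | no i≮m | no i′≮m
  move-convex (left i q) (left i′ q′) (left i″ q″) eq c<w w<e | no i≮m | no i′≮m =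
    left i″ q″ , fixed (ℕ.≤-trans (ℕ.≮⇒≥ i′≮m) (after w<e))
    where
    after : ∀ {u u′} → ([] , i″ , u) <ₖ ([] , i′ , u′) → i′ ℕ.≤ i″
    after (inj₁ (base ()))
    after (inj₂ (_ , inj₁ i″>i′))      = ℕ.<⇒≤ i″>i′
    after (inj₂ (_ , inj₂ (refl , _))) = ℕ.≤-refl
  -- The two ends belong to the same half of a cut.
  move-convex (left i q) (room (_ ∷ _) _ _ _ _) w eq c<w w<e | yes i<m =
    contradiction (proj₁ (append-injective (β i q) false eq)) (ℕ.<⇒≢ (s≤s (ℕ.m∸n≤m m i)))
  move-convex (left i q) (left i′ q′) w eq c<w w<e | yes i<m with i′ ℕ.<? m
  ... | no _ = contradiction (sym eq) (append-positive (β i q) (ℕ.m<n⇒0<n∸m i<m))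
  ... | yes i′<m with m∸i≡ , b≡ ← append-injective (β i q) (β i′ q′) eq
                 with refl ← ℕ.∸-cancelˡ-≡ (ℕ.<⇒≤ i<m) (ℕ.<⇒≤ i′<m) m∸i≡ = same w c<w w<e
    where
    same : ∀ w → (m ∷ [] , i , β i q , q) <ₖ key γ w → key γ w <ₖ (m ∷ [] , i , β i q′ , q′) →
           ∃[ d ] pieceOf d ≡ append (m ℕ.∸ i) (β i q) × move d ≡ w
    same w c<w w<e
      with r , w≡ , q<r , r<q′ ← key-squeeze (key γ w) c<w
             (subst (λ b → key γ w <ₖ (m ∷ [] , i , b , q′)) (sym b≡) w<e) =
      image w w≡ q<r r<q′
      where
      image : ∀ w {r} → key γ w ≡ (m ∷ [] , i , β i q , r) → q ℚ.< r → r ℚ.< q′ →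
              ∃[ d ] pieceOf d ≡ append (m ℕ.∸ i) (β i q) × move d ≡ w
      image (room .(m ∷ []) .i v .(β i q) r) refl q<r r<q′
        with side ← between i (β i q) refl (sym b≡) q<r r<q′ =
        left i r , trans (proj₁ (moved r i<m)) (cong (append _) side) ,
        trans (proj₂ (moved r i<m))
          (trans (cong (λ b → room _ i _ b r) side) (cong (λ v → room _ i v _ r) (◂-irrelevant _ _)))

  module _ (em : ExcludedMiddle 0ℓ) where

    movePoint : Point → Point
    movePoint (point c s j j≤w) = point (move c) s j
      (subst (j ℕ.≤_) (cong labelWeight (sym (label-move c))) j≤w)

    absorb : ∀ {ℓ} {𝓛 : Pred Lin ℓ} → Finite ⊆ 𝓛 → orderOf em β ⊴[ 𝓛 ] orderOf em γ
    absorb fin = finitePiecewise⇒⊴ em (point (left 0 0ℚ) 0ℚ 0 z≤n)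
      (pieceOf ∘ column) (suc (append (suc m) false)) (λ x → s≤s (slot≤ (proj₁ (key β (column x))) _ _))
      fin (pointEnumeration em) (pointEnumeration em) β.≺-isStrictTotalOrder γ.≺-isStrictTotalOrder
      (λ {x} {y} → piece-mono {x} {y}) movePoint
      (λ {x} {y} → movePoint-mono {x} {y}) (λ {x} {z} {w} → movePoint-convex {x} {z} {w})
      where
      piece-mono : ∀ {x y} → x β.≺ y → pieceOf (column x) ℕ.≤ pieceOf (column y)
      piece-mono {x} {y} (inj₁ c<d)    = slot-mono (key β (column x)) (key β (column y)) c<d
      piece-mono (inj₂ (refl , _))     = ℕ.≤-refl

      movePoint-mono : ∀ {x y} → x β.≺ y → movePoint x γ.≺ movePoint y
      movePoint-mono {x} {y} (inj₁ c<d) = inj₁ (move-mono {column x} {column y} c<d)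
      movePoint-mono (inj₂ (refl , lt)) = inj₂ (refl , lt)

      movePoint-convex : ∀ {x z w} → pieceOf (column x) ≡ pieceOf (column z) →
                         movePoint x γ.≺ w → w γ.≺ movePoint z →
                         ∃[ y ] pieceOf (column y) ≡ pieceOf (column x) × movePoint y ≡ w
      movePoint-convex {x} {z} {w@(point d s j j≤w)} eq x<w w<z with preimage x<w w<z
        where
        preimage : movePoint x γ.≺ w → w γ.≺ movePoint z → ∃[ c ] pieceOf c ≡ pieceOf (column x) × move c ≡ d
        preimage (inj₂ (c≡d , _)) _                = column x , refl , c≡d
        preimage (inj₁ _)         (inj₂ (d≡c , _)) = column z , sym eq , sym d≡c
        preimage (inj₁ c<d)       (inj₁ d<e)       = move-convex (column x) (column z) d eq c<d d<e
      ... | c , piece≡ , refl =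
        point c s j (subst (j ℕ.≤_) (cong labelWeight (label-move c)) j≤w)
        , piece≡ , point-≡ refl refl refl

-- Recovering almost all coordinates from an embedding

<ₗ⇒head≤ : ∀ {a l b k} → a ∷ l <ₗ b ∷ k → a ℕ.≤ b
<ₗ⇒head≤ (this a<b)    = ℕ.<⇒≤ a<b
<ₗ⇒head≤ (next refl _) = ℕ.≤-refl

module Recover (em : ExcludedMiddle 0ℓ) (β γ : ℕ → ℚ → Bool) {K : Lin} (scattered : Scat K)
               (e : PiecewiseEmbedding (SequenceOrder._≺_ β) (SequenceOrder._≺_ γ) K) where
  open PiecewiseEmbedding e
  private
    module β = SequenceOrder β
    module γ = SequenceOrder γ

  -- Some point of the left column at (i , q) goes to the left column at (i , q).
  Fixed : ℕ → ℚ → Set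
  Fixed i q = ∃[ x ] column x ≡ left i q × column (map x) ≡ left i q

  -- Some point of a left column goes into the room.
  Hit : Set
  Hit = ∃[ x ] ∃[ j ] ∃[ q ] ∃[ α ] ∃[ i ] ∃[ v ] ∃[ b ] ∃[ r ]
        column x ≡ left j q × column (map x) ≡ room α i v b r

  label-preserved : ∀ c → ∃[ x ] column x ≡ c × label (column (map x)) ≡ label c
  label-preserved c
    with x , x∈c , w≡ ←
           weight-preserved weight weight em β.isStrictTotalOrder γ.isStrictTotalOrder scattered e c =
    x , x∈c , weight-injective (column (map x)) c w≡

  eventually-fixed : ∃[ m ] ∀ i → m ℕ.≤ i → ∀ q → Fixed i q
  eventually-fixed with em {Hit}
  ... | no ¬hit = 0 , λ i _ q → avoid i q (label-preserved (left i q))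
    where
    avoid : ∀ i q → ∃[ x ] column x ≡ left i q × label (column (map x)) ≡ (i , q) → Fixed i q
    avoid i q (x , x∈ , lab) with column (map x) in eq
    avoid i q (x , x∈ , refl) | left .i .q         = x , x∈ , eq
    avoid i q (x , x∈ , lab)  | room α i′ v b r =
      contradiction (x , i , q , α , i′ , v , b , r , x∈ , eq) ¬hit
  ... | yes (y , j , _ , [] , _ , () , _)
  ... | yes (y , j , q₀ , a ∷ l , i₀ , v₀ , b₀ , r₀ , y∈ , fy∈) =
    -- For i > j the left columns at i lie before the given one, and the part of
    -- the room up to its image has only labels i < a.
    suc j ℕ.⊔ a , λ i m≤i q → bounded i q m≤i (label-preserved (left i q))
    where
    bounded : ∀ i q → suc j ℕ.⊔ a ℕ.≤ i →
              ∃[ x ] column x ≡ left i q × label (column (map x)) ≡ (i , q) → Fixed i q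
    bounded i q m≤i (x , x∈ , lab) with column (map x) in eq
    bounded i q m≤i (x , x∈ , refl) | left .i .q = x , x∈ , eq
    bounded i q m≤i (x , x∈ , refl) | room [] .i () b .q
    bounded i q m≤i (x , x∈ , refl) | room (a′ ∷ l′) .i v b .q =
      contradiction (ℕ.m⊔n≤o⇒n≤o (suc j) a m≤i) (ℕ.<⇒≱ (ℕ.≤-trans (◂⇒<head v) (head≤ below)))
      where
      x≺y : x β.≺ y
      x≺y = inj₁ (subst₂ (λ c d → c β.< d) (sym x∈) (sym y∈)
              (inj₂ (refl , inj₁ (ℕ.m⊔n≤o⇒m≤o (suc j) a m≤i))))
      fx = room (a′ ∷ l′) i v b q
      fy = room (a ∷ l) i₀ v₀ b₀ r₀
      below : fx γ.< fy ⊎ fx ≡ fy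
      below with map-mono x≺y
      ... | inj₁ lt       = inj₁ (subst₂ (λ c d → c γ.< d) eq fy∈ lt)
      ... | inj₂ (eq′ , _) = inj₂ (trans (sym eq) (trans eq′ fy∈))
      head≤ : fx γ.< fy ⊎ fx ≡ fy → a′ ℕ.≤ a
      head≤ (inj₁ (inj₁ lt))         = <ₗ⇒head≤ lt
      head≤ (inj₁ (inj₂ (refl , _))) = ℕ.≤-refl
      head≤ (inj₂ refl)              = ℕ.≤-refl

  side-preserved : ∀ {i q r} → Fixed i q → Fixed i r → q ≢ r →
                   Side (β i q , q) (β i r , r) → Side (γ i q , q) (γ i r , r)
  side-preserved {i} {q} {r} (x , x∈ , fx∈) (y , y∈ , fy∈) q≢r side
    with map-mono {x} {y}
           (inj₁ (subst₂ (λ c d → c β.< d) (sym x∈) (sym y∈) (inj₂ (refl , inj₂ (refl , side)))))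
  ... | inj₂ (eq , _) = contradiction (cong (proj₂ ∘ label) (trans (sym fx∈) (trans eq fy∈))) q≢r
  ... | inj₁ lt = strip (subst₂ (λ c d → c γ.< d) fx∈ fy∈ lt)
    where
    strip : left i q γ.< left i r → Side (γ i q , q) (γ i r , r)
    strip (inj₁ (base ()))
    strip (inj₂ (_ , inj₁ i>i))       = contradiction i>i (ℕ.<-irrefl refl)
    strip (inj₂ (_ , inj₂ (_ , side))) = side

bits : (ℕ → ℝ) → ℕ → ℚ → Bool
bits x i q = ℝ.below (x i) q

below-< : (x : ℝ) → ∀ {p q} → T (ℝ.below x p) → ℝ.below x q ≡ false → p ℚ.< q
below-< x {p} {q} p∈ q∉ with ℚ.<-cmp p q
... | tri< p<q _ _  = p<q
... | tri≈ _ refl _ = ⊥-elim (subst T q∉ p∈)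
... | tri> _ _ q<p  = ⊥-elim (subst T q∉ (ℝ.downward x q<p p∈))

-- A cut is determined by the order in which it arranges the rationals.  If q
-- is below just one of x and y, take t below that one and so below both: in
-- one of the two arrangements t comes before q, and in the other q before t.
side-determines : (x y : ℝ) →
  (∀ q r → q ≢ r → Side (ℝ.below x q , q) (ℝ.below x r , r) → Side (ℝ.below y q , q) (ℝ.below y r , r)) →
  x ≈ᴿ y
side-determines x y preserved q with ℝ.below x q in xq | ℝ.below y q in yq
... | true  | true  = refl
... | false | false = refl
... | true  | false with t , t∈ ← ℝ.inhabited y
                    with t<q ← below-< y t∈ yq
                    with ℝ.below x t in xt | ℝ.downward x t<q (subst T (sym xq) _)
                       | ℝ.below y t in yt | t∈
...   | true | _ | true | _ = contradiction
          (subst₂ (λ b c → Side (b , t) (c , q)) yt yq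
            (preserved t q (λ t≡q → ℚ.<-irrefl t≡q t<q)
              (subst₂ (λ b c → Side (b , t) (c , q)) (sym xt) (sym xq) (inj₂ (refl , t<q)))))
          λ { (inj₁ ()) ; (inj₂ (() , _)) }
side-determines x y preserved q | false | true
                    with t , t∈ ← ℝ.inhabited x
                    with t<q ← below-< x t∈ xq
                    with ℝ.below y t in yt | ℝ.downward y t<q (subst T (sym yq) _)
                       | ℝ.below x t in xt | t∈
...   | true | _ | true | _ = contradiction
          (subst₂ (λ b c → Side (b , q) (c , t)) yq yt
            (preserved q t (λ q≡t → ℚ.<-irrefl (sym q≡t) t<q)
              (subst₂ (λ b c → Side (b , q) (c , t)) (sym xq) (sym xt) (inj₁ f<t))))
          λ { (inj₁ ()) ; (inj₂ (_ , q<t)) → ℚ.<-asym q<t t<q }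

-- Borel maps into the space of codes

module _ (em : ExcludedMiddle 0ℓ) {X : Space} where
  private
    C = Space.Carrier X

  borel-∪ : ∀ {A B : Pred C 0ℓ} → Borel X A → Borel X B → Borel X (λ x → A x ⊎ B x)
  borel-∪ {A} {B} a b = resp-≐
    ((λ { (zero , x∈) → inj₁ x∈ ; (suc _ , x∈) → inj₂ x∈ }) ,
     (λ { (inj₁ x∈) → 0 , x∈ ; (inj₂ x∈) → 1 , x∈ }))
    (union {A = seq} λ { zero → a ; (suc _) → b })
    where
    seq : ℕ → Pred C 0ℓ
    seq zero    = A
    seq (suc _) = B

  borel-∩ : ∀ {A B : Pred C 0ℓ} → Borel X A → Borel X B → Borel X (λ x → A x × B x)
  borel-∩ {A} {B} a b = resp-≐
    ((λ {x} ¬∪ → stable (A x) (λ x∉ → ¬∪ (inj₁ x∉)) , stable (B x) (λ x∉ → ¬∪ (inj₂ x∉))) ,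
     (λ { (x∈A , x∈B) (inj₁ x∉) → x∉ x∈A ; (x∈A , x∈B) (inj₂ x∉) → x∉ x∈B }))
    (complement (borel-∪ (complement a) (complement b)))
    where
    stable : (P : Set) → ¬ ¬ P → P
    stable P ¬¬p with em {P}
    ... | yes p = p
    ... | no ¬p = contradiction ¬p ¬¬p

  module _ (β : C → ℕ → Bool) (β-borel : ∀ n → Borel X (λ x → T (β x n))) where

    -- Equality of the first n bits.
    Agree : ℕ → Rel C 0ℓ
    Agree n x y = ∀ k → k ℕ.< n → β x k ≡ β y k

    -- A set is Borel if membership in it depends on finitely many bits.
    borel-bits : ∀ n (A : Pred C 0ℓ) → (∀ {x y} → Agree n x y → A x → A y) → Borel X A
    borel-bits zero A invariant with em {∃[ x ] A x}
    ... | yes (x , x∈) = resp-≐ ((λ ¬∅ → invariant (λ _ ()) x∈) , λ _ → λ ())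
                           (complement (open-set {U = λ _ → ⊥} λ ()))
    ... | no  empty    = open-set λ x∈ → contradiction (_ , x∈) empty
    borel-bits (suc n) A invariant = resp-≐ (to , from)
      (borel-∪ (borel-∩ (β-borel n) (part true)) (borel-∩ (complement (β-borel n)) (part false)))
      where
      Part : Bool → Pred C 0ℓ
      Part b x = ∃[ y ] Agree n x y × β y n ≡ b × A y
      part : ∀ b → Borel X (Part b)
      part b = borel-bits n (Part b)
        λ { agree (z , agree′ , bz , z∈) →
              z , (λ k k<n → trans (sym (agree k k<n)) (agree′ k k<n)) , bz , z∈ }
      extend : ∀ {x y b} → Agree n x y → β x n ≡ b → β y n ≡ b → Agree (suc n) y x
      extend agree bx by k k<1+n with ℕ.m≤n⇒m<n∨m≡n (ℕ.s≤s⁻¹ k<1+n)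
      ... | inj₁ k<n  = sym (agree k k<n)
      ... | inj₂ refl = trans by (sym bx)
      isTrue : ∀ {b} → T b → b ≡ true
      isTrue {true} _ = refl
      isFalse : ∀ {b} → ¬ T b → b ≡ false
      isFalse {true}  ¬t = contradiction _ ¬t
      isFalse {false} _  = refl
      to : ∀ {x} → (T (β x n) × Part true x) ⊎ (¬ T (β x n) × Part false x) → A x
      to (inj₁ (t , y , agree , by , y∈)) = invariant (extend agree (isTrue t) by) y∈
      to (inj₂ (t , y , agree , by , y∈)) = invariant (extend agree (isFalse t) by) y∈
      from : ∀ {x} → A x → (T (β x n) × Part true x) ⊎ (¬ T (β x n) × Part false x)
      from {x} x∈ with β x n in bx
      ... | true  = inj₁ (_ , x , (λ _ _ → refl) , bx , x∈)
      ... | false = inj₂ (id , x , (λ _ _ → refl) , bx , x∈)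

    -- A map into codes is Borel if its entry at (m , n) depends on the bits m
    -- and n.  The preimage of an open set is the union over n of the sets of
    -- those points whose first n bits alone force their image into it.
    borel-map : (φ : C → LO) →
      (∀ {x y} m n → β x m ≡ β y m → β x n ≡ β y n →
        Lin.code (proj₁ (φ x)) (m , n) ≡ Lin.code (proj₁ (φ y)) (m , n)) →
      IsBorelMap X LOSpace φ
    borel-map φ local (complement b)  = complement (borel-map φ local b)
    borel-map φ local (union bs)      = union (λ n → borel-map φ local (bs n))
    borel-map φ local (resp-≐ (⊆ , ⊇) b) = resp-≐ (⊆ , ⊇) (borel-map φ local b)
    borel-map φ local (open-set {U} U-open) = resp-≐ ((λ (n , x∈) → x∈ _ λ _ _ → refl) , from)
      (union λ n → borel-bits n (Interior n)
        λ agree x∈ z agree′ → x∈ z (λ k k<n → trans (agree k k<n) (agree′ k k<n)))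
      where
      -- Every point with the same first n bits as x goes into U.
      Interior : ℕ → Pred C 0ℓ
      Interior n x = ∀ y → Agree n x y → U (φ y)
      Cylinder : Space.Index LOSpace → Pred C 0ℓ
      Cylinder cs x = Space.base LOSpace cs (φ x)
      determined : ∀ cs x → Cylinder cs x → ∃[ n ] ∀ y → Agree n x y → Cylinder cs y
      determined []                  x []         = 0 , λ _ _ → []
      determined (((m , n) , b) ∷ cs) x (eq ∷ x∈) with k , rest ← determined cs x x∈ =
        suc (m ℕ.⊔ n) ℕ.⊔ k , λ y agree →
          trans (sym (local m n (agree m (ℕ.≤-trans (s≤s (ℕ.m≤m⊔n m n)) (ℕ.m≤m⊔n _ k)))
                                (agree n (ℕ.≤-trans (s≤s (ℕ.m≤n⊔m m n)) (ℕ.m≤m⊔n _ k))))) eq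
          ∷ rest y λ l l<k → agree l (ℕ.≤-trans l<k (ℕ.m≤n⊔m (suc (m ℕ.⊔ n)) k))
      from : ∀ {x} → U (φ x) → ∃[ n ] Interior n x
      from {x} x∈ with cs , x∈cs , cs⊆U ← U-open x∈ with n , det ← determined cs x x∈cs =
        n , λ y agree → cs⊆U (det y agree)

-- The reduction of E₁

below-open : ∀ i q → Open ℝ^ℕ (λ x → T (ℝ.below (x i) q))
below-open i q {x} q∈ with r , r∉ ← ℝ.bounded (x i) with s , r<s ← ∃> r =
  (i , q , s) ∷ [] , (q∈ , r , r<s , r∉) ∷ [] , λ { ((q∈ , _) ∷ []) → q∈ }

-- The bit of a sequence that determines the key of a column.
bitOf : Column → (ℕ → ℝ) → Bool
bitOf (left i q)         x = bits x i q
bitOf (room _ _ _ _ _) x = false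

key-bit : ∀ c {x y} → bitOf c x ≡ bitOf c y → key (bits x) c ≡ key (bits y) c
key-bit (left i q)         eq = cong (λ b → [] , i , b , q) eq
key-bit (room _ _ _ _ _) _  = refl

bit-borel : ∀ c → Borel ℝ^ℕ (λ x → T (bitOf c x))
bit-borel (left i q)         = open-set {U = λ x → T (bits x i q)} λ {x} → below-open i q {x}
bit-borel (room _ _ _ _ _) = open-set λ ()

module _ (em : ExcludedMiddle 0ℓ) where

  reduction : (ℕ → ℝ) → LO
  reduction x =
    orderOf em (bits x) , lin-full (pointEnumeration em) (SequenceOrder.≺-isStrictTotalOrder (bits x))

  reduction-borel : IsBorelMap ℝ^ℕ LOSpace reduction
  reduction-borel = borel-map em (λ x n → bitOf (col n) x) (λ n → bit-borel (col n)) reduction local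
    where
    col : ℕ → Column
    col n = column (Inverse.from (pointEnumeration em) n)
    local : ∀ {x y} m n → bitOf (col m) x ≡ bitOf (col m) y → bitOf (col n) x ≡ bitOf (col n) y →
            Lin.code (proj₁ (reduction x)) (m , n) ≡ Lin.code (proj₁ (reduction y)) (m , n)
    local {x} {y} m n eqₘ eqₙ = isNo-cong
      (transfer (key-bit (col n) eqₙ) (key-bit (col m) eqₘ))
      (transfer (sym (key-bit (col n) eqₙ)) (sym (key-bit (col m) eqₘ)))
      where
      p = Inverse.from (pointEnumeration em) n
      q = Inverse.from (pointEnumeration em) m
      transfer : ∀ {β γ : ℕ → ℚ → Bool} → key β (col n) ≡ key γ (col n) → key β (col m) ≡ key γ (col m) →
                 SequenceOrder._≺_ β p q → SequenceOrder._≺_ γ p q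
      transfer eqₙ eqₘ (inj₁ lt) = inj₁ (subst₂ _<ₖ_ eqₙ eqₘ lt)
      transfer eqₙ eqₘ (inj₂ r)  = inj₂ r
      isNo-cong : {P Q : Set} {P? : Dec P} {Q? : Dec Q} → (P → Q) → (Q → P) → isNo P? ≡ isNo Q?
      isNo-cong {P? = yes _} {yes _} _ _ = refl
      isNo-cong {P? = no _}  {no _}  _ _ = refl
      isNo-cong {P? = yes p} {no ¬q} f _ = contradiction (f p) ¬q
      isNo-cong {P? = no ¬p} {yes q} _ g = contradiction (g q) ¬p

  E₁⇒⊴ : ∀ {ℓ} {𝓛 : Pred Lin ℓ} → Finite ⊆ 𝓛 → ∀ x y → E₁ x y →
         proj₁ (reduction x) ⊴[ 𝓛 ] proj₁ (reduction y)
  E₁⇒⊴ fin x y (m , x≈y) = Absorb.absorb (bits x) (bits y) m x≈y (λ i → ℝ.downward (x i)) em fin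

  ⊴⇒E₁ : ∀ {ℓ} {𝓛 : Pred Lin ℓ} → 𝓛 ⊆ Scat → ∀ x y →
         proj₁ (reduction x) ⊴[ 𝓛 ] proj₁ (reduction y) → E₁ x y
  ⊴⇒E₁ {𝓛 = 𝓛} scat x y x⊴y = recover (⊴⇒piecewise (pointEnumeration em) (pointEnumeration em)
    (SequenceOrder.≺-isStrictTotalOrder (bits x)) (SequenceOrder.≺-isStrictTotalOrder (bits y)) {𝓛 = 𝓛} x⊴y)
    where
    recover : ∃[ K ] K ∈ 𝓛 ×
              PiecewiseEmbedding (SequenceOrder._≺_ (bits x)) (SequenceOrder._≺_ (bits y)) K → E₁ x y
    recover (K , K∈𝓛 , e) =
      proj₁ R.eventually-fixed , λ i m≤i → side-determines (x i) (y i) λ q r →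
      R.side-preserved (proj₂ R.eventually-fixed i m≤i q) (proj₂ R.eventually-fixed i m≤i r)
      where module R = Recover em (bits x) (bits y) (scat {K} K∈𝓛) e

theorem6p4 : ∀ {ℓ : Level} → ExcludedMiddle (lsuc 0ℓ ⊔ ℓ) →
    (𝓛 : Pred Lin ℓ) → DownwardClosed 𝓛 → CCS 𝓛 → Finite ⊆ 𝓛 → 𝓛 ⊆ Scat →
    BorelReducible ℝ^ℕ LOSpace E₁ ⋈[ 𝓛 ]
theorem6p4 {ℓ} em 𝓛 _ _ fin scat = reduction em₀ , reduction-borel em₀ , λ x y → mk⇔
  (λ x~y → E₁⇒⊴ em₀ {𝓛 = 𝓛} fin x y x~y , E₁⇒⊴ em₀ {𝓛 = 𝓛} fin y x (E₁-sym {x} {y} x~y))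
  (λ (x⊴y , _) → ⊴⇒E₁ em₀ {𝓛 = 𝓛} scat x y x⊴y)
  where
  em₀ : ExcludedMiddle 0ℓ
  em₀ = lowerEM (lsuc 0ℓ ⊔ ℓ) em
  E₁-sym : ∀ {x y} → E₁ x y → E₁ y x
  E₁-sym (m , x≈y) = m , λ n m≤n q → sym (x≈y n m≤n q)
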